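{- Let $\mathcal{S}\subseteq \mathbb{R}_{\geq 0}$ be a countable universal spectrum and let $\boldsymbol{U}_{\mathcal{S}}$ be the countable homogeneous universal metric space with spectrum $\mathcal{S}$. Then the distinguishing number satisfies $D(\boldsymbol{U}_{\mathcal{S}})=2$ or $D(\boldsymbol{U}_{\mathcal{S}})=\omega$, and the following hold. (1) If $\mathcal{S}$ has a positive limit (not necessarily in $\mathcal{S}$), then $D(\boldsymbol{U}_{\mathcal{S}})=2$. (2) If $\mathcal{S}$ has no positive limit but has $0$ as a limit, then $D(\boldsymbol{U}_{\mathcal{S}})=2$ if and only if $\mathcal{S}$ contains arbitrarily large elements of arbitrarily small distance, i.e. for every real $N$ and every $\varepsilon>0$ there exist $a<b$ in $\mathcal{S}$ with $a\geq N$ and $b-a<\varepsilon$. (3) If $\mathcal{S}$ does not have a limit, then $D(\boldsymbol{U}_{\mathcal{S}})=2$ if and only if $\mathcal{S}$ contains two positive elements $a<b$ with $b-a\leq \min\{s\in\mathcal{S}: s>0\}$.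
   Context: The spectrum of a metric space is the set of distances between its points (including $0$). For $\mathcal{S}\subseteq\mathbb{R}_{\geq 0}$, let $\mathfrak{A}(\mathcal{S})$ be the class of finite metric spaces whose spectrum is a subset of $\mathcal{S}$. $\mathcal{S}$ satisfies the 4-values condition if, whenever $\boldsymbol{A}$ on points $\{x,y,z\}$ and $\boldsymbol{B}$ on points $\{x,y,w\}$ are in $\mathfrak{A}(\mathcal{S})$ ($x,y,z,w$ distinct) with $d_{\boldsymbol{A}}(x,y)=d_{\boldsymbol{B}}(x,y)$, there is a metric space in $\mathfrak{A}(\mathcal{S})$ on $\{x,y,z,w\}$ extending both. A countable set $\mathcal{S}\subseteq\mathbb{R}_{\geq 0}$ is a universal spectrum if $0\in\mathcal{S}$, $\mathcal{S}$ contains at least one positive number, and $\mathcal{S}$ satisfies the 4-values condition. For a universal spectrum $\mathcal{S}$ it is known (Fraïssé theory) that $\mathfrak{A}(\mathcal{S})$ has the amalgamation property, and $\boldsymbol{U}_{\mathcal{S}}$ denotes its Fraïssé limit: the (unique up to isometry) countable metric space with spectrum $\mathcal{S}$ that is homogeneous (every isometry between finite subspaces extends to an automorphism, i.e. a bijective self-isometry, of the whole space) and universal (it embeds isometrically every member of $\mathfrak{A}(\mathcal{S})$). A limit of $\mathcal{S}$ is an accumulation point of $\mathcal{S}$ in $\mathbb{R}$ (not necessarily belonging to $\mathcal{S}$). The distinguishing number $D(\boldsymbol{M})$ of a structure $\boldsymbol{M}$ is the least cardinal $k$ such that the underlying set can be partitioned into $k$ cells so that only the identity automorphism of $\boldsymbol{M}$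 fixes every cell setwise. -}

module Defs where

open import Level using (0ℓ)
open import Algebra.Core using (Op₁; Op₂)
open import Algebra.Structures using (IsCommutativeRing)
open import Data.Fin.Base using (Fin; punchIn)
open import Data.Fin.Patterns using (0F; 1F; 2F; 3F)
open import Data.Nat.Base using (ℕ)
open import Data.Product.Base using (Σ-syntax; ∃; ∃-syntax; ∃₂; _×_)
open import Function.Bundles using (_⤖_; _↠_; _↣_; Bijection)
open import Function.Definitions using (StrictlySurjective)
open import Function.Metric.Structures using (IsGeneralMetric)
open import Relation.Binary.Core using (Rel)
open import Relation.Binary.Definitions using (_Respects_)
open import Relation.Binary.PropositionalEquality.Core using (_≡_)
open import Relation.Binary.Structures using (IsStrictTotalOrder)
open import Relation.Nullary.Negation.Core using (¬_)
open import Relation.Unary using (Pred; _∈_; _⊆_; _≐_)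
import Relation.Binary.Construct.StrictToNonStrict as ToNonStrict

-- The real numbers are axiomatised as a Dedekind-complete ordered field,
-- which determines them up to isomorphism.  Given excluded middle the record
-- is inhabited, e.g. by Dedekind cuts represented as functions ℚ → Bool.

record CompleteOrderedField : Set₁ where
  infix  4 _≈_ _<_ _≤_
  infixl 6 _+_ _-_
  infixl 7 _*_
  infix  8 -_
  field
    Carrier            : Set
    _≈_ _<_            : Rel Carrier 0ℓ
    _+_ _*_            : Op₂ Carrier
    -_                 : Op₁ Carrier
    0# 1#              : Carrier
    isCommutativeRing  : IsCommutativeRing _≈_ _+_ _*_ -_ 0# 1#
    isStrictTotalOrder : IsStrictTotalOrder _≈_ _<_
    0<1                : 0# < 1#
    inverse            : ∀ x → ¬ (x ≈ 0#) → ∃[ y ] x * y ≈ 1#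
    +-monoˡ-<          : ∀ {x y} z → x < y → x + z < y + z
    *-pos              : ∀ {x y} → 0# < x → 0# < y → 0# < x * y

  _≤_ : Rel Carrier 0ℓ
  _≤_ = ToNonStrict._≤_ _≈_ _<_

  _-_ : Op₂ Carrier
  x - y = x + (- y)

  UpperBound : Pred Carrier 0ℓ → Pred Carrier 0ℓ
  UpperBound P u = ∀ {x} → x ∈ P → x ≤ u

  field
    complete : (P : Pred Carrier 0ℓ) → ∃ P → ∃ (UpperBound P) →
               ∃[ s ] s ∈ UpperBound P × (∀ {u} → u ∈ UpperBound P → s ≤ u)

module Spectra (ℝ : CompleteOrderedField) where

  open CompleteOrderedField ℝ

  record Metric (A : Set) : Set where
    field
      d        : A → A → Carrier
      isMetric : IsGeneralMetric _≡_ _≈_ _≤_ 0# _+_ d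

  record MetricSpace : Set₁ where
    field
      Point  : Set
      metric : Metric Point
    open Metric metric public

  open MetricSpace using (Point)

  spectrum : MetricSpace → Pred Carrier 0ℓ
  spectrum M s = ∃₂ λ x y → d x y ≈ s
    where open MetricSpace M

  Finite : Pred MetricSpace 0ℓ
  Finite M = ∃[ n ] Point M ⤖ Fin n

  𝔄 : Pred Carrier 0ℓ → Pred MetricSpace 0ℓ
  𝔄 S M = Finite M × spectrum M ⊆ S

  on : ∀ {A} → Metric A → MetricSpace
  on m = record { metric = m }

  -- The points x, y, z, w are 0F, 1F, 2F, 3F in Fin 4.  The metrics A and B
  -- live on copies of {x, y, z} and {x, y, w}: punchIn 3F omits w and
  -- punchIn 2F omits z, so both send 0F and 1F to x and y.
  FourValues : Pred Carrier 0ℓ → Set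
  FourValues S =
    (A B : Metric (Fin 3)) → on A ∈ 𝔄 S → on B ∈ 𝔄 S →
    d A 0F 1F ≈ d B 0F 1F →
    Σ[ C ∈ Metric (Fin 4) ] on C ∈ 𝔄 S ×
      (∀ i j → d C (punchIn 3F i) (punchIn 3F j) ≈ d A i j) ×
      (∀ i j → d C (punchIn 2F i) (punchIn 2F j) ≈ d B i j)
    where open Metric

  record IsUniversalSpectrum (S : Pred Carrier 0ℓ) : Set where
    field
      resp-≈      : S Respects _≈_
      nonNegative : S ⊆ (0# ≤_)
      countable   : Σ[ e ∈ (ℕ → Carrier) ] (∀ {s} → s ∈ S → ∃[ n ] e n ≈ s)
      0∈S         : 0# ∈ S
      positive    : ∃[ s ] s ∈ S × 0# < s
      fourValues  : FourValues S

  record Embedding (M N : MetricSpace) : Set where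
    private
      module M = MetricSpace M
      module N = MetricSpace N
    field
      to        : M.Point → N.Point
      isometric : ∀ x y → N.d (to x) (to y) ≈ M.d x y

  record Automorphism (M : MetricSpace) : Set where
    open MetricSpace M hiding (Point)
    field
      bijection : Point M ⤖ Point M
    open Bijection bijection public using (to)
    field
      isometric : ∀ x y → d (to x) (to y) ≈ d x y

  -- Isometries between finite subspaces of M are presented as pairs of
  -- embeddings e, f of one finite space A: the isometry is f ∘ e⁻¹ from the
  -- image of e onto the image of f.
  Homogeneous : MetricSpace → Set₁
  Homogeneous M =
    (A : MetricSpace) → Finite A → (e f : Embedding A M) →
    Σ[ g ∈ Automorphism M ]
      (∀ a → Automorphism.to g (Embedding.to e a) ≡ Embedding.to f a)

  record IsUrysohn (S : Pred Carrier 0ℓ) (U : MetricSpace) : Set₁ where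
    field
      countable   : ℕ ↠ Point U
      hasSpectrum : spectrum U ≐ S
      homogeneous : Homogeneous U
      universal   : (A : MetricSpace) → A ∈ 𝔄 S → Embedding A U

  cell : ∀ {A K : Set} → (A → K) → K → Pred A 0ℓ
  cell c k x = c x ≡ k

  image : ∀ {A : Set} → (A → A) → Pred A 0ℓ → Pred A 0ℓ
  image f P y = ∃[ x ] x ∈ P × f x ≡ y

  -- A partition of the points into K cells is a surjection onto K, so that
  -- cells are nonempty.
  record DistinguishingPartition (M : MetricSpace) (K : Set) : Set where
    field
      cellOf         : Point M → K
      nonempty       : StrictlySurjective _≡_ cellOf
      distinguishing :
        (g : Automorphism M) →
        (∀ k → image (Automorphism.to g) (cell cellOf k) ≐ cell cellOf k) →
        ∀ x → Automorphism.to g x ≡ x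

  -- D M ≔ K says that the distinguishing number of M is the cardinality of K.
  record D_≔_ (M : MetricSpace) (K : Set) : Set₁ where
    field
      attained : DistinguishingPartition M K
      least    : (K′ : Set) → DistinguishingPartition M K′ → K ↣ K′

  IsLimit : Pred Carrier 0ℓ → Pred Carrier 0ℓ
  IsLimit S p = ∀ ε → 0# < ε →
    ∃[ s ] s ∈ S × ¬ (s ≈ p) × p - ε < s × s < p + ε

  HasPositiveLimit : Pred Carrier 0ℓ → Set
  HasPositiveLimit S = ∃[ p ] 0# < p × IsLimit S p

  LargeElementsOfSmallDistance : Pred Carrier 0ℓ → Set
  LargeElementsOfSmallDistance S = ∀ N ε → 0# < ε →
    ∃₂ λ a b → a ∈ S × b ∈ S × a < b × N ≤ a × b - a < ε

  IsLeastPositive : Pred Carrier 0ℓ → Pred Carrier 0ℓ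
  IsLeastPositive S m = m ∈ S × 0# < m × (∀ {s} → s ∈ S → 0# < s → m ≤ s)

{-# OPTIONS --safe #-}
module Submission where

-- D = 2.  Colour finitely many new points red at each stage.  Stage n marks the
-- n-th point u by red points at some distance a ∈ S from u, where neither these
-- nor any later red points are at distance a from a point enumerated before u.
-- Such red points exist once S contains suitable pairs a < b whose difference is
-- at most the distances already realised: put a new point at distance a from u
-- and at distance ≥ b from everything else.  The numbers of red points at the
-- various distances then tell all points apart.
--
-- D = ω.  If positive gaps in S exceed its least positive element m, transposing
-- two points at distance m is an automorphism.  If 0 is the only limit and the
-- gaps of S are bounded below away from 0, some ball V has all its finitely many
-- colours dense in it, and moves of V by less than the gaps do not affect the
-- distances to its complement; a back-and-forth by such moves gives a nontrivial
-- colour-preserving automorphism.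

open import Defs
open import Level using (0ℓ)
open import Algebra.Bundles using (CommutativeRing)
open import Axiom.ExcludedMiddle using (ExcludedMiddle)
open import Data.Fin.Base using (Fin; zero; suc; toℕ)
open import Data.Fin.Patterns using (0F; 1F)
open import Data.Fin.Properties using (injective⇒≤; suc-injective; toℕ-injective)
open import Data.List.Base using (List; []; _∷_; _++_; lookup; deduplicate; length; map; filter; applyUpTo)
open import Data.List.Membership.Propositional using () renaming (_∈_ to _∈ˡ_; _∉_ to _∉ˡ_)
open import Data.List.Membership.Propositional.Properties
  using (∈-lookup; ∈-deduplicate⁺; ∈-deduplicate⁻; ∈-++⁺ˡ; ∈-++⁺ʳ; ∈-++⁻; ∈-map⁺; ∈-map⁻;
         ∈-filter⁺; ∈-filter⁻; ∈-applyUpTo⁺; ∈-applyUpTo⁻)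
open import Data.List.Properties using (length-map; map-∘; map-id; filter-notAll)
import Data.List.Relation.Unary.All as All
open import Data.List.Relation.Unary.AllPairs using ([]; _∷_)
open import Data.List.Relation.Unary.Any as Any using (here; there; index)
open import Data.List.Relation.Unary.Any.Properties using (lookup-index)
open import Data.List.Relation.Unary.Unique.DecPropositional.Properties using (deduplicate-!)
open import Data.List.Relation.Unary.Unique.Propositional using (Unique)
import Data.List.Relation.Unary.Unique.Propositional.Properties as Unique
open import Data.Nat.Base as ℕ using (ℕ; zero; suc)
import Data.Nat.Properties as ℕ
open import Data.Product.Base using (Σ; Σ-syntax; ∃; ∃-syntax; ∃₂; _×_; _,_; proj₁; proj₂; swap)
open import Data.Sum.Base using (_⊎_; inj₁; inj₂)
open import Data.Unit.Base using (⊤; tt)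
open import Function.Base using (_∘_)
open import Function.Bundles using (Bijection; Surjection; Injection; _↣_; _⇔_; mk↣; mk⤖; mk⇔)
open import Function.Construct.Identity using (⤖-id)
open import Function.Construct.Symmetry using (⤖-sym)
open import Function.Definitions using (Injective; StrictlySurjective)
open import Function.Metric.Structures using (IsGeneralMetric)
open import Relation.Binary.Bundles using (StrictPartialOrder)
open import Relation.Binary.Definitions using (DecidableEquality; tri<; tri≈; tri>)
open import Relation.Binary.PropositionalEquality.Core
  using (_≡_; _≢_; refl; sym; trans; cong; cong₂; subst)
open import Relation.Binary.PropositionalEquality.Properties using (isEquivalence)
open import Relation.Binary.Structures using (IsStrictTotalOrder; IsPartialOrder)
open import Relation.Nullary.Decidable.Core using (Dec; yes; no)
open import Relation.Nullary.Negation.Core using (¬_; contradiction)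
open import Relation.Unary using (Pred; _∈_; _≐_)
import Algebra.Solver.CommutativeMonoid
import Relation.Binary.Construct.StrictToNonStrict as ToNonStrict
import Relation.Binary.Reasoning.StrictPartialOrder

-- New red points must avoid every distance used so far, and this shapes the cases. If suitable
-- pairs a < b with b above all used distances exist, all distances except the one to u are raised
-- to at least b, and the used ones are avoided by size. If S accumulates at a positive p only from
-- above, suitable pairs are guaranteed only close to p, below the used distances, and raising alone
-- can hit a used one. Two consecutive elements e < f of S between p and 2p then provide a second
-- scale: points near u get distance exactly b, below all used distances, and the others at least
-- `e*`, above all of them. If no such consecutive pair is found, S is approached from below
-- somewhere, which is the easy case.
--
-- For infinite D the lower bound takes the form that every rigid colouring, with any set of
-- colours, has infinitely many. When 0 is the only limit, positive distances are locally constant,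
-- so a point can be exchanged for a nearby one of a prescribed colour without changing its
-- distances to finitely many other points. This is why density of the colours suffices for the
-- back-and-forth.

-- Order and linear arithmetic in a complete ordered field.

module OrderedFieldProperties (ℝ : CompleteOrderedField) where

  open CompleteOrderedField ℝ

  commutativeRing : CommutativeRing 0ℓ 0ℓ
  commutativeRing = record { isCommutativeRing = isCommutativeRing }

  open CommutativeRing commutativeRing public
    using (+-cong; +-congˡ; +-congʳ; +-assoc; +-comm; +-identityˡ; +-identityʳ;
           -‿inverseʳ; -‿inverseˡ; *-assoc; *-congʳ; *-identityˡ; distribʳ; +-commutativeMonoid)
    renaming (refl to ≈-refl; sym to ≈-sym; trans to ≈-trans)

  open IsStrictTotalOrder isStrictTotalOrder public
    using (compare; isStrictPartialOrder)
    renaming (irrefl to <-irrefl; trans to <-trans;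
              <-respʳ-≈ to <-respʳ; <-respˡ-≈ to <-respˡ)

  strictPartialOrder : StrictPartialOrder 0ℓ 0ℓ 0ℓ
  strictPartialOrder = record { isStrictPartialOrder = isStrictPartialOrder }

  module ≤-Reasoning = Relation.Binary.Reasoning.StrictPartialOrder strictPartialOrder
  open ≤-Reasoning
  open Algebra.Solver.CommutativeMonoid +-commutativeMonoid public
    using (solve; _⊜_; _⊕_)

  ≤-isPartialOrder : IsPartialOrder _≈_ _≤_
  ≤-isPartialOrder = ToNonStrict.isPartialOrder _≈_ _<_ isStrictPartialOrder

  open IsPartialOrder ≤-isPartialOrder public
    using () renaming (trans to ≤-trans; antisym to ≤-antisym; reflexive to ≤-reflexive;
                       ≤-respˡ-≈ to ≤-respˡ; ≤-respʳ-≈ to ≤-respʳ)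

  ≤-refl : ∀ {x} → x ≤ x
  ≤-refl = inj₂ ≈-refl

  ≡⇒≈ : ∀ {x y} → x ≡ y → x ≈ y
  ≡⇒≈ refl = ≈-refl

  <⇒≤ : ∀ {x y} → x < y → x ≤ y
  <⇒≤ = inj₁

  <-≤-trans : ∀ {x y z} → x < y → y ≤ z → x < z
  <-≤-trans = ToNonStrict.<-≤-trans _≈_ _<_ <-trans <-respʳ

  ≤-<-trans : ∀ {x y z} → x ≤ y → y < z → x < z
  ≤-<-trans = ToNonStrict.≤-<-trans _≈_ _<_ ≈-sym <-trans <-respˡ

  ≤⇒≯ : ∀ {x y} → x ≤ y → ¬ (y < x)
  ≤⇒≯ x≤y y<x = <-irrefl ≈-refl (<-≤-trans y<x x≤y)

  <⇒≉ : ∀ {x y} → x < y → ¬ (x ≈ y)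
  <⇒≉ x<y x≈y = <-irrefl x≈y x<y

  >⇒≉ : ∀ {x y} → y < x → ¬ (x ≈ y)
  >⇒≉ y<x x≈y = <-irrefl (≈-sym x≈y) y<x

  <-≤-connex : ∀ x y → x < y ⊎ y ≤ x
  <-≤-connex x y with compare x y
  ... | tri< x<y _ _ = inj₁ x<y
  ... | tri≈ _ x≈y _ = inj₂ (inj₂ (≈-sym x≈y))
  ... | tri> _ _ y<x = inj₂ (inj₁ y<x)

  ≮⇒≥ : ∀ {x y} → ¬ (x < y) → y ≤ x
  ≮⇒≥ {x} {y} x≮y with <-≤-connex x y
  ... | inj₁ x<y = contradiction x<y x≮y
  ... | inj₂ y≤x = y≤x

  ≤∧≉⇒< : ∀ {x y} → x ≤ y → ¬ (x ≈ y) → x < y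
  ≤∧≉⇒< (inj₁ x<y) _   = x<y
  ≤∧≉⇒< (inj₂ x≈y) x≉y = contradiction x≈y x≉y

  +-monoʳ-< : ∀ {x y} z → x < y → z + x < z + y
  +-monoʳ-< z x<y = <-respˡ (+-comm _ z) (<-respʳ (+-comm _ z) (+-monoˡ-< z x<y))

  +-monoˡ-≤ : ∀ {x y} z → x ≤ y → x + z ≤ y + z
  +-monoˡ-≤ z (inj₁ x<y) = inj₁ (+-monoˡ-< z x<y)
  +-monoˡ-≤ z (inj₂ x≈y) = inj₂ (+-congʳ x≈y)

  +-monoʳ-≤ : ∀ {x y} z → x ≤ y → z + x ≤ z + y
  +-monoʳ-≤ z (inj₁ x<y) = inj₁ (+-monoʳ-< z x<y)
  +-monoʳ-≤ z (inj₂ x≈y) = inj₂ (+-congˡ x≈y)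

  +-mono-≤ : ∀ {x y u v} → x ≤ y → u ≤ v → x + u ≤ y + v
  +-mono-≤ x≤y u≤v = ≤-trans (+-monoˡ-≤ _ x≤y) (+-monoʳ-≤ _ u≤v)

  +-mono-<-≤ : ∀ {x y u v} → x < y → u ≤ v → x + u < y + v
  +-mono-<-≤ x<y u≤v = <-≤-trans (+-monoˡ-< _ x<y) (+-monoʳ-≤ _ u≤v)

  +-mono-≤-< : ∀ {x y u v} → x ≤ y → u < v → x + u < y + v
  +-mono-≤-< x≤y u<v = ≤-<-trans (+-monoˡ-≤ _ x≤y) (+-monoʳ-< _ u<v)

  +-mono-< : ∀ {x y u v} → x < y → u < v → x + u < y + v
  +-mono-< x<y u<v = +-mono-<-≤ x<y (<⇒≤ u<v)

  +-cancelʳ-< : ∀ {x y} z → x + z < y + z → x < y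
  +-cancelʳ-< {x} {y} z lt with <-≤-connex x y
  ... | inj₁ x<y = x<y
  ... | inj₂ y≤x = contradiction lt (≤⇒≯ (+-monoˡ-≤ z y≤x))

  +-cancelʳ-≤ : ∀ {x y} z → x + z ≤ y + z → x ≤ y
  +-cancelʳ-≤ {x} {y} z le with <-≤-connex y x
  ... | inj₁ y<x = contradiction (+-monoˡ-< z y<x) (≤⇒≯ le)
  ... | inj₂ x≤y = x≤y

  -- A linear consequence l ≤ r ⇒ x ≤ y is certified by the subtraction-free
  -- identity x + r ≈ y + l, which the commutative monoid solver decides.
  linear-≤ : ∀ {l r x y} → l ≤ r → x + r ≈ y + l → x ≤ y
  linear-≤ {r = r} l≤r eq =
    +-cancelʳ-≤ r (≤-trans (≤-reflexive eq) (+-monoʳ-≤ _ l≤r))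

  linear-< : ∀ {l r x y} → l < r → x + r ≈ y + l → x < y
  linear-< {r = r} l<r eq =
    +-cancelʳ-< r (≤-<-trans (≤-reflexive eq) (+-monoʳ-< _ l<r))

  x≤x+y : ∀ {x y} → 0# ≤ y → x ≤ x + y
  x≤x+y {x} 0≤y = ≤-respˡ (+-identityʳ x) (+-monoʳ-≤ x 0≤y)

  x≤y+x : ∀ {x y} → 0# ≤ y → x ≤ y + x
  x≤y+x 0≤y = ≤-respʳ (+-comm _ _) (x≤x+y 0≤y)

  x<x+y : ∀ {x y} → 0# < y → x < x + y
  x<x+y {x} 0<y = <-respˡ (+-identityʳ x) (+-monoʳ-< x 0<y)

  +-pos : ∀ {x y} → 0# < x → 0# < y → 0# < x + y
  +-pos 0<x 0<y = <-trans 0<x (x<x+y 0<y)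

  [x-y]+y≈x : ∀ x y → (x - y) + y ≈ x
  [x-y]+y≈x x y = ≈-trans (+-assoc x (- y) y)
    (≈-trans (+-congˡ (-‿inverseˡ y)) (+-identityʳ x))

  x-y<z⇒x<z+y : ∀ {x y z} → x - y < z → x < z + y
  x-y<z⇒x<z+y lt = <-respˡ ([x-y]+y≈x _ _) (+-monoˡ-< _ lt)

  x-y≤z⇒x≤z+y : ∀ {x y z} → x - y ≤ z → x ≤ z + y
  x-y≤z⇒x≤z+y le = ≤-respˡ ([x-y]+y≈x _ _) (+-monoˡ-≤ _ le)

  x<z+y⇒x-y<z : ∀ {x y z} → x < z + y → x - y < z
  x<z+y⇒x-y<z {y = y} lt = +-cancelʳ-< y (<-respˡ (≈-sym ([x-y]+y≈x _ _)) lt)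

  x<y⇒0<y-x : ∀ {x y} → x < y → 0# < y - x
  x<y⇒0<y-x {x} x<y = <-respˡ (-‿inverseʳ x) (+-monoˡ-< (- x) x<y)

  half : ∀ {ε} → 0# < ε → ∃[ h ] 0# < h × h + h ≈ ε
  half {ε} 0<ε = h , 0<h , h+h≈ε
    where
    2≉0 : ¬ (1# + 1# ≈ 0#)
    2≉0 = >⇒≉ (+-pos 0<1 0<1)
    y h : Carrier
    y = proj₁ (inverse (1# + 1#) 2≉0)
    h = y * ε
    h+h≈ε : h + h ≈ ε
    h+h≈ε = begin-equality
      h + h              ≈⟨ +-cong (*-identityˡ h) (*-identityˡ h) ⟨
      1# * h + 1# * h    ≈⟨ distribʳ h 1# 1# ⟨
      (1# + 1#) * h      ≈⟨ *-assoc (1# + 1#) y ε ⟨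
      (1# + 1#) * y * ε  ≈⟨ *-congʳ (proj₂ (inverse (1# + 1#) 2≉0)) ⟩
      1# * ε             ≈⟨ *-identityˡ ε ⟩
      ε                  ∎
    0<h : 0# < h
    0<h with <-≤-connex 0# h
    ... | inj₁ 0<h = 0<h
    ... | inj₂ h≤0 = contradiction 0<ε
      (≤⇒≯ (≤-respˡ h+h≈ε (≤-respʳ (+-identityˡ 0#) (+-mono-≤ h≤0 h≤0))))

  minimum⁺ : ∀ {x y} → 0# < x → 0# < y → ∃[ z ] 0# < z × z ≤ x × z ≤ y
  minimum⁺ {x} {y} 0<x 0<y with <-≤-connex x y
  ... | inj₁ x<y = x , 0<x , ≤-refl , <⇒≤ x<y
  ... | inj₂ y≤x = y , 0<y , y≤x , ≤-refl

  maximumOf : ∀ x ℓ → ∃[ N ] N ∈ˡ x ∷ ℓ × (∀ {y} → y ∈ˡ x ∷ ℓ → y ≤ N)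
  maximumOf x []      = x , here refl , λ where (here refl) → ≤-refl
  maximumOf x (y ∷ ℓ) with maximumOf y ℓ
  ... | N , N∈ , ≤N with <-≤-connex x N
  ...   | inj₁ x<N = N , there N∈ , λ where
          (here refl) → <⇒≤ x<N
          (there z∈)  → ≤N z∈
  ...   | inj₂ N≤x = x , here refl , λ where
          (here refl) → ≤-refl
          (there z∈)  → ≤-trans (≤N z∈) N≤x

  minimumOf : ∀ x ℓ → ∃[ N ] N ∈ˡ x ∷ ℓ × (∀ {y} → y ∈ˡ x ∷ ℓ → N ≤ y)
  minimumOf x []      = x , here refl , λ where (here refl) → ≤-refl
  minimumOf x (y ∷ ℓ) with minimumOf y ℓ
  ... | N , N∈ , N≤ with <-≤-connex x N
  ...   | inj₁ x<N = x , here refl , λ where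
          (here refl) → ≤-refl
          (there z∈)  → ≤-trans (<⇒≤ x<N) (N≤ z∈)
  ...   | inj₂ N≤x = N , there N∈ , λ where
          (here refl) → N≤x
          (there z∈)  → N≤ z∈

lookup-injective : ∀ {A : Set} {xs : List A} → Unique xs → Injective _≡_ _≡_ (lookup xs)
lookup-injective (_ ∷ _)    {zero}  {zero}  _  = refl
lookup-injective (x∉ ∷ _)   {zero}  {suc j} eq = contradiction eq (All.lookup x∉ (∈-lookup j))
lookup-injective (x∉ ∷ _)   {suc i} {zero}  eq = contradiction (sym eq) (All.lookup x∉ (∈-lookup i))
lookup-injective (_ ∷ uniq) {suc i} {suc j} eq = cong suc (lookup-injective uniq eq)

-- The metric of the homogeneous universal space U.

module Urysohn (em : ExcludedMiddle 0ℓ) (ℝ : CompleteOrderedField)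
  (S : Pred (CompleteOrderedField.Carrier ℝ) 0ℓ) (universal-S : Spectra.IsUniversalSpectrum ℝ S)
  (U : Spectra.MetricSpace ℝ) (urysohn : Spectra.IsUrysohn ℝ S U) where

  open CompleteOrderedField ℝ
  open Spectra ℝ
  open OrderedFieldProperties ℝ
  open MetricSpace U
  open IsUniversalSpectrum universal-S using (resp-≈; nonNegative; 0∈S; positive)
  open IsUrysohn urysohn
  open Automorphism using (to)
  open IsGeneralMetric isMetric using () renaming
    (sym to d-sym; triangle to d-triangle; nonNegative to 0≤d; ≈⇒0 to ≡⇒d≈0; 0⇒≈ to d≈0⇒≡)

  infix 4 _≟_
  _≟_ : DecidableEquality Point
  _ ≟ _ = em

  d-refl : ∀ x → d x x ≈ 0#
  d-refl x = ≡⇒d≈0 refl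

  d∈S : ∀ x y → d x y ∈ S
  d∈S x y = proj₁ hasSpectrum (x , y , ≈-refl)

  d>0 : ∀ {x y} → x ≢ y → 0# < d x y
  d>0 {x} {y} x≢y = ≤∧≉⇒< 0≤d λ 0≈d → x≢y (d≈0⇒≡ (≈-sym 0≈d))

  d>0⇒≢ : ∀ {x y} → 0# < d x y → x ≢ y
  d>0⇒≢ 0<d refl = <⇒≉ 0<d (≈-sym (d-refl _))

  d-triangleˡ : ∀ x y z → d x z ≤ d y x + d y z
  d-triangleˡ x y z = ≤-respʳ (+-congʳ (d-sym x y)) (d-triangle x y z)

  d-triangleʳ : ∀ x y z → d x z ≤ d x y + d z y
  d-triangleʳ x y z = ≤-respʳ (+-congˡ (d-sym y z)) (d-triangle x y z)

  -- Only positive values are bounded, so that with φ = d z the list may contain z itself.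
  -- Membership of μ in S lets it serve as the distance of a new point.
  lowerBound : ∀ {A : Set} (φ : A → Carrier) → (∀ x → φ x ∈ S) → (ℓ : List A) →
               ∃[ μ ] μ ∈ S × 0# < μ × (∀ {x} → x ∈ˡ ℓ → 0# < φ x → μ ≤ φ x)
  lowerBound φ φ∈S [] with positive
  ... | s , s∈S , 0<s = s , s∈S , 0<s , λ ()
  lowerBound φ φ∈S (x ∷ ℓ) with lowerBound φ φ∈S ℓ | <-≤-connex 0# (φ x)
  ... | μ , μ∈S , 0<μ , μ≤ | inj₂ φx≤0 = μ , μ∈S , 0<μ , λ where
        (here refl) 0<φx → contradiction 0<φx (≤⇒≯ φx≤0)
        (there z∈ℓ) → μ≤ z∈ℓ
  ... | μ , μ∈S , 0<μ , μ≤ | inj₁ 0<φx with <-≤-connex (φ x) μ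
  ...   | inj₁ φx<μ = φ x , φ∈S x , 0<φx , λ where
          (here refl) _    → ≤-refl
          (there z∈ℓ) 0<φz → ≤-trans (<⇒≤ φx<μ) (μ≤ z∈ℓ 0<φz)
  ...   | inj₂ μ≤φx = μ , μ∈S , 0<μ , λ where
          (here refl) _ → μ≤φx
          (there z∈ℓ)   → μ≤ z∈ℓ

  -- Extending finite isometries, and new points with prescribed distances.

  subspace : ∀ {n} (h : Fin n → Point) → Injective _≡_ _≡_ h → MetricSpace
  subspace {n} h h-injective = record
    { Point  = Fin n
    ; metric = record
      { d        = λ i j → d (h i) (h j)
      ; isMetric = record
        { isSemiMetric = record
          { isQuasiSemiMetric = record
            { isPreMetric = record
              { isProtoMetric = record
                { isPartialOrder  = ≤-isPartialOrder
                ; ≈-isEquivalence = isEquivalence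
                ; cong            = λ where refl refl → ≈-refl
                ; nonNegative     = 0≤d
                }
              ; ≈⇒0 = λ where refl → d-refl _
              }
            ; 0⇒≈ = λ d≈0 → h-injective (d≈0⇒≡ d≈0)
            }
          ; sym = λ i j → d-sym (h i) (h j)
          }
        ; triangle = λ i j k → d-triangle (h i) (h j) (h k)
        }
      }
    }

  extendIsometry : ∀ {n} (h k : Fin n → Point) → Injective _≡_ _≡_ h →
                   (∀ i j → d (h i) (h j) ≈ d (k i) (k j)) →
                   Σ[ g ∈ Automorphism U ] (∀ i → to g (h i) ≡ k i)
  extendIsometry {n} h k h-injective iso =
    homogeneous (subspace h h-injective) (n , ⤖-id (Fin n))
      (record { to = h ; isometric = λ _ _ → ≈-refl })
      (record { to = k ; isometric = λ i j → ≈-sym (iso i j) })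

  PartialIsometry : List (Point × Point) → Set
  PartialIsometry L = ∀ {x x′ y y′} → (x , x′) ∈ˡ L → (y , y′) ∈ˡ L → d x y ≈ d x′ y′

  extendPartialIsometry : ∀ L → PartialIsometry L →
    Σ[ g ∈ Automorphism U ] (∀ {x x′} → (x , x′) ∈ˡ L → to g x ≡ x′)
  extendPartialIsometry L iso =
    proj₁ extension , λ p∈L → subst (λ p → to (proj₁ extension) (proj₁ p) ≡ proj₂ p)
      (sym (lookup-index (∈-deduplicate⁺ _≟²_ p∈L))) (proj₂ extension (index (∈-deduplicate⁺ _≟²_ p∈L)))
    where
    _≟²_ : DecidableEquality (Point × Point)
    _ ≟² _ = em
    L! = deduplicate _≟²_ L
    ∈L : ∀ i → lookup L! i ∈ˡ L
    ∈L i = ∈-deduplicate⁻ _≟²_ L (∈-lookup i)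
    -- Two pairs with the same first coordinate coincide, because distance 0 is carried to distance
    -- 0; after `deduplicate` they have the same index.
    h-injective : Injective _≡_ _≡_ (λ i → proj₁ (lookup L! i))
    h-injective {i} {j} eq = lookup-injective (deduplicate-! _≟²_ L) (cong₂ _,_ eq
      (d≈0⇒≡ (≈-trans (≈-sym (iso (∈L i) (∈L j))) (≡⇒d≈0 eq))))
    extension = extendIsometry (λ i → proj₁ (lookup L! i)) (λ i → proj₂ (lookup L! i))
      h-injective (λ i j → iso (∈L i) (∈L j))

  -- The two families of inequalities are the triangle inequalities that involve the new point.
  -- Universality embeds the abstract extended space somewhere in U, and homogeneity carries the
  -- embedded copy of h back onto h.
  onePointExtension : ∀ {n} (h : Fin n → Point) → Injective _≡_ _≡_ h → (t : Fin n → Carrier) →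
    (∀ i → t i ∈ S) → (∀ i → 0# < t i) →
    (∀ i j → t i ≤ t j + d (h i) (h j)) → (∀ i j → d (h i) (h j) ≤ t i + t j) →
    ∃[ x ] ∀ i → d x (h i) ≈ t i
  onePointExtension {n} h h-injective t t∈S 0<t t-lipschitz d≤t+t = to g (e zero) , λ i →
    ≈-trans (≡⇒≈ (cong (d (to g (e zero))) (sym (g-e i))))
      (≈-trans (Automorphism.isometric g (e zero) (e (suc i))) (Embedding.isometric ε zero (suc i)))
    where
    d′ : Fin (ℕ.suc n) → Fin (ℕ.suc n) → Carrier
    d′ zero    zero    = 0#
    d′ zero    (suc j) = t j
    d′ (suc i) zero    = t i
    d′ (suc i) (suc j) = d (h i) (h j)
    ≡⇒d′≈0 : ∀ {i j} → i ≡ j → d′ i j ≈ 0#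
    ≡⇒d′≈0 {zero}  refl = ≈-refl
    ≡⇒d′≈0 {suc i} refl = d-refl (h i)
    0≤d′ : ∀ i j → 0# ≤ d′ i j
    0≤d′ zero    zero    = ≤-refl
    0≤d′ zero    (suc j) = <⇒≤ (0<t j)
    0≤d′ (suc i) zero    = <⇒≤ (0<t i)
    0≤d′ (suc i) (suc j) = 0≤d
    d′≈0⇒≡ : ∀ i j → d′ i j ≈ 0# → i ≡ j
    d′≈0⇒≡ zero    zero    _  = refl
    d′≈0⇒≡ zero    (suc j) eq = contradiction eq (>⇒≉ (0<t j))
    d′≈0⇒≡ (suc i) zero    eq = contradiction eq (>⇒≉ (0<t i))
    d′≈0⇒≡ (suc i) (suc j) eq = cong suc (h-injective (d≈0⇒≡ eq))
    d′-sym : ∀ i j → d′ i j ≈ d′ j i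
    d′-sym zero    zero    = ≈-refl
    d′-sym zero    (suc j) = ≈-refl
    d′-sym (suc i) zero    = ≈-refl
    d′-sym (suc i) (suc j) = d-sym (h i) (h j)
    d′-triangle : ∀ i j k → d′ i k ≤ d′ i j + d′ j k
    d′-triangle zero    j       zero    = ≤-respˡ (+-identityˡ 0#) (+-mono-≤ (0≤d′ zero j) (0≤d′ j zero))
    d′-triangle zero    zero    (suc k) = x≤y+x ≤-refl
    d′-triangle zero    (suc j) (suc k) = ≤-respʳ (+-congˡ (d-sym (h k) (h j))) (t-lipschitz k j)
    d′-triangle (suc i) zero    zero    = x≤x+y ≤-refl
    d′-triangle (suc i) (suc j) zero    = ≤-respʳ (+-comm _ _) (t-lipschitz i j)
    d′-triangle (suc i) zero    (suc k) = d≤t+t i k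
    d′-triangle (suc i) (suc j) (suc k) = d-triangle (h i) (h j) (h k)
    A : MetricSpace
    A = record
      { Point  = Fin (ℕ.suc n)
      ; metric = record
        { d        = d′
        ; isMetric = record
          { isSemiMetric = record
            { isQuasiSemiMetric = record
              { isPreMetric = record
                { isProtoMetric = record
                  { isPartialOrder  = ≤-isPartialOrder
                  ; ≈-isEquivalence = isEquivalence
                  ; cong            = λ where refl refl → ≈-refl
                  ; nonNegative     = λ {i} {j} → 0≤d′ i j
                  }
                ; ≈⇒0 = ≡⇒d′≈0
                }
              ; 0⇒≈ = d′≈0⇒≡ _ _
              }
            ; sym = d′-sym
            }
          ; triangle = d′-triangle
          }
        }
      }
    d′∈S : ∀ i j → d′ i j ∈ S
    d′∈S zero    zero    = 0∈S
    d′∈S zero    (suc j) = t∈S j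
    d′∈S (suc i) zero    = t∈S i
    d′∈S (suc i) (suc j) = d∈S (h i) (h j)
    ε : Embedding A U
    ε = universal A ((ℕ.suc n , ⤖-id _) , λ (i , j , eq) → resp-≈ eq (d′∈S i j))
    open Embedding ε using () renaming (to to e)
    e-injective : ∀ {i j} → e i ≡ e j → i ≡ j
    e-injective {i} {j} eq =
      d′≈0⇒≡ i j (≈-trans (≈-sym (Embedding.isometric ε i j)) (≡⇒d≈0 eq))
    back = extendIsometry (λ i → e (suc i)) h (λ eq → suc-injective (e-injective eq))
      (λ i j → Embedding.isometric ε (suc i) (suc j))
    g = proj₁ back
    g-e = proj₂ back

  -- The new point copies the distances from z to F and lies at β from y; the three bounds are the
  -- triangle inequalities for the new point, y and g. If y or z already belongs to F, they force d
  -- z y = β, and z itself serves.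
  adjust : ∀ z y F {β} → β ∈ S → 0# < β →
    (∀ {g} → g ∈ˡ F → β ≤ d z g + d g y) →
    (∀ {g} → g ∈ˡ F → d z g ≤ β + d g y) →
    (∀ {g} → g ∈ˡ F → d g y ≤ β + d z g) →
    ∃[ x ] d x y ≈ β × (∀ {g} → g ∈ˡ F → d x g ≈ d z g)
  adjust z y F {β} β∈S 0<β β≤ zg≤ gy≤ with em {y ∈ˡ F} | em {z ∈ˡ F}
  ... | yes y∈F | _ = z , ≤-antisym
          (≤-respʳ (≈-trans (+-congˡ (d-refl y)) (+-identityʳ β)) (zg≤ y∈F))
          (≤-respʳ (≈-trans (+-congˡ (d-refl y)) (+-identityʳ _)) (β≤ y∈F)) , λ _ → ≈-refl
  ... | no _ | yes z∈F = z , ≤-antisym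
          (≤-respʳ (≈-trans (+-congˡ (d-refl z)) (+-identityʳ β)) (gy≤ z∈F))
          (≤-respʳ (≈-trans (+-congʳ (d-refl z)) (+-identityˡ _)) (β≤ z∈F)) , λ _ → ≈-refl
  ... | no y∉F | no z∉F = proj₁ extension , proj₂ extension zero , λ g∈F →
          let i = ∈-deduplicate⁺ _≟_ g∈F in
          subst (λ p → d (proj₁ extension) p ≈ d z p) (sym (lookup-index i)) (proj₂ extension (suc (index i)))
    where
    F! = deduplicate _≟_ F
    ∈F : ∀ i → lookup F! i ∈ˡ F
    ∈F i = ∈-deduplicate⁻ _≟_ F (∈-lookup i)
    h : Fin (ℕ.suc (length F!)) → Point
    h zero    = y
    h (suc i) = lookup F! i
    t : Fin (ℕ.suc (length F!)) → Carrier
    t zero    = β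
    t (suc i) = d z (lookup F! i)
    h-injective : Injective _≡_ _≡_ h
    h-injective {zero}  {zero}  _  = refl
    h-injective {zero}  {suc j} eq = contradiction (subst (_∈ˡ F) (sym eq) (∈F j)) y∉F
    h-injective {suc i} {zero}  eq = contradiction (subst (_∈ˡ F) eq (∈F i)) y∉F
    h-injective {suc i} {suc j} eq = cong suc (lookup-injective (deduplicate-! _≟_ F) eq)
    t∈S : ∀ i → t i ∈ S
    t∈S zero    = β∈S
    t∈S (suc i) = d∈S _ _
    0<t : ∀ i → 0# < t i
    0<t zero    = 0<β
    0<t (suc i) = d>0 λ eq → z∉F (subst (_∈ˡ F) (sym eq) (∈F i))
    t-lipschitz : ∀ i j → t i ≤ t j + d (h i) (h j)
    t-lipschitz zero    zero    = x≤x+y 0≤d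
    t-lipschitz zero    (suc j) = ≤-respʳ (+-congˡ (d-sym _ y)) (β≤ (∈F j))
    t-lipschitz (suc i) zero    = zg≤ (∈F i)
    t-lipschitz (suc i) (suc j) = d-triangleʳ z _ _
    d≤t+t : ∀ i j → d (h i) (h j) ≤ t i + t j
    d≤t+t zero    zero    = ≤-respˡ (≈-sym (d-refl y)) (<⇒≤ (+-pos 0<β 0<β))
    d≤t+t zero    (suc j) = ≤-respˡ (d-sym _ y) (gy≤ (∈F j))
    d≤t+t (suc i) zero    = ≤-respʳ (+-comm _ _) (gy≤ (∈F i))
    d≤t+t (suc i) (suc j) = d-triangleˡ _ z _
    extension = onePointExtension h h-injective t t∈S 0<t t-lipschitz d≤t+t

  point : Point
  point = proj₁ (proj₂ hasSpectrum 0∈S)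

  atDistance : ∀ y {s} → s ∈ S → 0# < s → ∃[ x ] d x y ≈ s
  atDistance y s∈S 0<s with adjust y y [] s∈S 0<s (λ ()) (λ ()) (λ ())
  ... | x , dxy≈s , _ = x , dxy≈s

  -- Points of H are handled one at a time by `adjust` and then join G. A handled point is at β
  -- exactly, so the bound d x g ≤ β persists, and the bound β + β on distances within H is the
  -- remaining triangle inequality.
  assign : ∀ x G H {β} → β ∈ S → 0# < β →
    (∀ {g} → g ∈ˡ G → d x g ≤ β) →
    (∀ {g h} → g ∈ˡ G → h ∈ˡ H → β ≤ d x g + d g h) →
    (∀ {g h} → g ∈ˡ G → h ∈ˡ H → d g h ≤ β + d x g) →
    (∀ {h k} → h ∈ˡ H → k ∈ˡ H → d h k ≤ β + β) →
    ∃[ x′ ] (∀ {g} → g ∈ˡ G → d x′ g ≈ d x g) × (∀ {h} → h ∈ˡ H → d x′ h ≈ β)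
  assign x G [] β∈S 0<β xg≤ β≤ gh≤ hk≤ = x , (λ _ → ≈-refl) , λ ()
  assign x G (h ∷ H) {β} β∈S 0<β xg≤ β≤ gh≤ hk≤
    with adjust x h G β∈S 0<β (λ g∈G → β≤ g∈G (here refl))
      (λ g∈G → ≤-trans (xg≤ g∈G) (x≤x+y 0≤d)) (λ g∈G → gh≤ g∈G (here refl))
  ... | x₁ , x₁h≈β , x₁-agrees
    with assign x₁ (h ∷ G) H β∈S 0<β
      (λ where
        (here refl) → ≤-reflexive x₁h≈β
        (there g∈G) → ≤-respˡ (≈-sym (x₁-agrees g∈G)) (xg≤ g∈G))
      (λ where
        (here refl) _   → ≤-trans (≤-reflexive (≈-sym x₁h≈β)) (x≤x+y 0≤d)
        (there g∈G) k∈H → ≤-respʳ (+-congʳ (≈-sym (x₁-agrees g∈G))) (β≤ g∈G (there k∈H)))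
      (λ where
        (here refl) k∈H → ≤-respʳ (+-congˡ (≈-sym x₁h≈β)) (hk≤ (here refl) (there k∈H))
        (there g∈G) k∈H → ≤-respʳ (+-congˡ (≈-sym (x₁-agrees g∈G))) (gh≤ g∈G (there k∈H)))
      (λ k∈H l∈H → hk≤ (there k∈H) (there l∈H))
  ... | x₂ , x₂-agrees , x₂≈β = x₂ ,
        (λ g∈G → ≈-trans (x₂-agrees (there g∈G)) (x₁-agrees g∈G)) , λ where
          (here refl) → ≈-trans (x₂-agrees (here refl)) x₁h≈β
          (there k∈H) → x₂≈β k∈H

  -- Only distances below β are changed, to exactly β. Increasing d x h relaxes the other two
  -- triangle inequalities with g, so the stated bound is the only one that could fail; it persists
  -- for handled points, which are at least β away.
  raise : ∀ x G H {β} → β ∈ S → 0# < β →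
    (∀ {g h} → g ∈ˡ G → h ∈ˡ H → β ≤ d x g + d g h) →
    ∃[ x′ ] (∀ {g} → g ∈ˡ G → d x′ g ≈ d x g) × (∀ {h} → h ∈ˡ H → β ≤ d x′ h)
  raise x G [] β∈S 0<β β≤ = x , (λ _ → ≈-refl) , λ ()
  raise x G (h ∷ H) {β} β∈S 0<β β≤ with raised
    where
    raised : ∃[ x₁ ] (∀ {g} → g ∈ˡ G → d x₁ g ≈ d x g) × β ≤ d x₁ h
    raised with <-≤-connex (d x h) β
    ... | inj₂ β≤xh = x , (λ _ → ≈-refl) , β≤xh
    ... | inj₁ xh<β with adjust x h G β∈S 0<β (λ g∈G → β≤ g∈G (here refl))
          (λ {g} _ → ≤-trans (d-triangleʳ x h g) (+-monoˡ-≤ _ (<⇒≤ xh<β)))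
          (λ {g} _ → ≤-trans (d-triangleˡ g x h) (≤-respʳ (+-comm _ _) (+-monoʳ-≤ _ (<⇒≤ xh<β))))
    ...   | x₁ , x₁h≈β , x₁-agrees = x₁ , x₁-agrees , ≤-reflexive (≈-sym x₁h≈β)
  ... | x₁ , x₁-agrees , β≤x₁h with raise x₁ (h ∷ G) H β∈S 0<β (λ where
        (here refl) _   → ≤-trans β≤x₁h (x≤x+y 0≤d)
        (there g∈G) k∈H → ≤-respʳ (+-congʳ (≈-sym (x₁-agrees g∈G))) (β≤ g∈G (there k∈H)))
  ...   | x₂ , x₂-agrees , β≤x₂ = x₂ ,
          (λ g∈G → ≈-trans (x₂-agrees (there g∈G)) (x₁-agrees g∈G)) , λ where
            (here refl) → ≤-respʳ (≈-sym (x₂-agrees (here refl))) β≤x₁h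
            (there k∈H) → β≤x₂ k∈H

  -- The twin lies at a distance σ from x that is at most every d x f, so it can share all distances
  -- from x to F.
  anotherRealisation : ∀ x F → x ∉ˡ F → ∃[ x′ ] x′ ≢ x × (∀ {f} → f ∈ˡ F → d x′ f ≈ d x f)
  anotherRealisation x F x∉F with lowerBound (d x) (d∈S x) F
  ... | σ , σ∈S , 0<σ , σ≤ with adjust x x F σ∈S 0<σ
        (λ f∈F → ≤-trans (σ≤ f∈F (0<xf f∈F)) (x≤x+y 0≤d))
        (λ {f} _ → ≤-trans (≤-reflexive (d-sym x f)) (x≤y+x (<⇒≤ 0<σ)))
        (λ {f} _ → ≤-trans (≤-reflexive (d-sym f x)) (x≤y+x (<⇒≤ 0<σ)))
        where
        0<xf : ∀ {f} → f ∈ˡ F → 0# < d x f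
        0<xf f∈F = d>0 λ where refl → x∉F f∈F
  ... | x′ , x′x≈σ , agrees = x′ , d>0⇒≢ (<-respʳ (≈-sym x′x≈σ) 0<σ) , agrees

  freshRealisation : ∀ x F G → x ∉ˡ F → ∃[ x′ ] x′ ∉ˡ G × (∀ {f} → f ∈ˡ F → d x′ f ≈ d x f)
  freshRealisation x F []      x∉F = x , (λ ()) , λ _ → ≈-refl
  freshRealisation x F (g ∷ G) x∉F with freshRealisation x F G x∉F
  ... | x₁ , x₁∉G , x₁-agrees with em {x₁ ≡ g}
  ...   | no  x₁≢g = x₁ , (λ where
            (here eq)    → x₁≢g eq
            (there x₁∈G) → x₁∉G x₁∈G) , x₁-agrees
  -- The replacement also keeps the distances to G. These are positive, so it cannot run into a
  -- point that was already avoided.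
  ...   | yes refl with anotherRealisation x₁ (F ++ G) x₁∉F++G
    where
    apart : ∀ {f} → f ∈ˡ F → x₁ ≢ f
    apart f∈F = d>0⇒≢ (<-respʳ (≈-sym (x₁-agrees f∈F)) (d>0 λ where refl → x∉F f∈F))
    x₁∉F++G : x₁ ∉ˡ F ++ G
    x₁∉F++G x₁∈ with ∈-++⁻ F x₁∈
    ... | inj₁ x₁∈F = apart x₁∈F refl
    ... | inj₂ x₁∈G = x₁∉G x₁∈G
  ...     | x₂ , x₂≢x₁ , x₂-agrees = x₂ , (λ where
              (here eq)    → x₂≢x₁ eq
              (there x₂∈G) → d>0⇒≢ (<-respʳ (≈-sym (x₂-agrees (∈-++⁺ʳ F x₂∈G)))
                (d>0 λ where refl → x₁∉G x₂∈G)) refl) ,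
              λ f∈F → ≈-trans (x₂-agrees (∈-++⁺ˡ f∈F)) (x₁-agrees f∈F)

  freshPoint : ∀ G → ∃[ x ] x ∉ˡ G
  freshPoint G with freshRealisation point [] G (λ ())
  ... | x , x∉G , _ = x , x∉G

  -- Automorphisms, colourings and the distinguishing number.

  Unique⊆⇒length≤ : ∀ {A : Set} {X Y : List A} → Unique X → (∀ {x} → x ∈ˡ X → x ∈ˡ Y) → length X ℕ.≤ length Y
  Unique⊆⇒length≤ {X = X} {Y} uniq X⊆Y = injective⇒≤ {f = λ i → index (X⊆Y (∈-lookup i))} λ {i} {j} eq →
    lookup-injective uniq (trans (lookup-index (X⊆Y (∈-lookup i)))
      (trans (cong (lookup Y) eq) (sym (lookup-index (X⊆Y (∈-lookup j))))))

  to-surjective : ∀ (g : Automorphism U) y → ∃[ x ] to g x ≡ y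
  to-surjective g y = to⁻ y , to∘to⁻ y
    where open Surjection (Bijection.surjection (Automorphism.bijection g)) using (to⁻; to∘to⁻)

  _⁻¹ : Automorphism U → Automorphism U
  g ⁻¹ = record
    { bijection = ⤖-sym (Automorphism.bijection g)
    ; isometric = λ x y → ≈-trans (≈-sym (Automorphism.isometric g _ _))
        (≡⇒≈ (cong₂ d (proj₂ (to-surjective g x)) (proj₂ (to-surjective g y))))
    }

  Preserves : ∀ {K : Set} → (Point → K) → Automorphism U → Set
  Preserves c g = ∀ x → c (to g x) ≡ c x

  Rigid : ∀ {K : Set} → (Point → K) → Set
  Rigid c = ∀ g → Preserves c g → ∀ x → to g x ≡ x

  Preserves-⁻¹ : ∀ {K : Set} (c : Point → K) g → Preserves c g → Preserves c (g ⁻¹)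
  Preserves-⁻¹ c g c∘g≡c x =
    trans (sym (c∘g≡c _)) (cong c (proj₂ (to-surjective g x)))

  Preserves⇒fixesCells : ∀ {K : Set} (c : Point → K) g → Preserves c g →
                         ∀ k → image (to g) (cell c k) ≐ cell c k
  Preserves⇒fixesCells c g c∘g≡c k =
    (λ where (x , cx≡k , refl) → trans (c∘g≡c x) cx≡k) ,
    (λ {y} cy≡k → let x , gx≡y = to-surjective g y in
       x , trans (sym (c∘g≡c x)) (trans (cong c gx≡y) cy≡k) , gx≡y)

  distinguishing⇒Rigid : ∀ {K} (P : DistinguishingPartition U K) →
                         Rigid (DistinguishingPartition.cellOf P)
  distinguishing⇒Rigid P g c∘g≡c = distinguishing g (Preserves⇒fixesCells cellOf g c∘g≡c)
    where open DistinguishingPartition P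

  Rigid⇒distinguishing : ∀ {K} (c : Point → K) → StrictlySurjective _≡_ c → Rigid c →
                         DistinguishingPartition U K
  Rigid⇒distinguishing c surj rigid = record
    { cellOf         = c
    ; nonempty       = surj
    ; distinguishing = λ g fixed → rigid g (λ x → proj₁ (fixed (c x)) (x , refl , refl))
    }

  -- Every automorphism preserves a constant colouring, and homogeneity moves any point to any
  -- other. This yields both the nonempty cells of a two-colouring and the lower bound 2.
  Rigid⇒nonconstant : ∀ {K : Set} (c : Point → K) → Rigid c → ∃₂ λ x y → c x ≢ c y
  Rigid⇒nonconstant c rigid with em {∃₂ λ x y → c x ≢ c y}
  ... | yes nonconstant = nonconstant
  ... | no constant = contradiction (trans (sym (rigid g preserves point)) gx≡y) x≢y
    where
    y = proj₁ (freshPoint (point ∷ []))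
    x≢y : point ≢ y
    x≢y eq = proj₂ (freshPoint (point ∷ [])) (here (sym eq))
    move = extendPartialIsometry ((point , y) ∷ []) λ where
      (here refl) (here refl) → ≈-trans (d-refl _) (≈-sym (d-refl _))
    g = proj₁ move
    gx≡y : to g point ≡ y
    gx≡y = proj₂ move (here refl)
    preserves : Preserves c g
    preserves x with em {c (to g x) ≡ c x}
    ... | yes eq = eq
    ... | no neq = contradiction (_ , _ , neq) constant

  Rigid⇒D≔2 : (c : Point → Fin 2) → Rigid c → D U ≔ Fin 2
  Rigid⇒D≔2 c rigid = record
    { attained = Rigid⇒distinguishing c surj rigid
    ; least    = λ K′ P → let x , y , cx≢cy = Rigid⇒nonconstant _ (distinguishing⇒Rigid P) in
        mk↣ {to = choose x y P} (choose-injective P cx≢cy)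
    }
    where
    surj : StrictlySurjective _≡_ c
    surj k with Rigid⇒nonconstant c rigid
    ... | x , y , cx≢cy with c x in cx | c y in cy
    surj 0F | x , y , cx≢cy | 0F | _  = x , cx
    surj 0F | x , y , cx≢cy | 1F | 0F = y , cy
    surj 1F | x , y , cx≢cy | 1F | _  = x , cx
    surj 1F | x , y , cx≢cy | 0F | 1F = y , cy
    surj _  | x , y , cx≢cy | 0F | 0F = contradiction refl cx≢cy
    surj _  | x , y , cx≢cy | 1F | 1F = contradiction refl cx≢cy
    open DistinguishingPartition using (cellOf)
    choose : ∀ {K′} → Point → Point → DistinguishingPartition U K′ → Fin 2 → K′
    choose x y P 0F = cellOf P x
    choose x y P 1F = cellOf P y
    choose-injective : ∀ {K′} (P : DistinguishingPartition U K′) {x y} → cellOf P x ≢ cellOf P y →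
                       Injective _≡_ _≡_ (choose x y P)
    choose-injective P neq {0F} {0F} _  = refl
    choose-injective P neq {0F} {1F} eq = contradiction eq neq
    choose-injective P neq {1F} {0F} eq = contradiction (sym eq) neq
    choose-injective P neq {1F} {1F} _  = refl

  -- A rigid two-colouring built along an enumeration.

  enumerate : ℕ → Point
  enumerate = Surjection.to countable

  before : ℕ → List Point
  before = applyUpTo enumerate

  -- The enumeration may repeat points, so a point is represented by its first occurrence.
  firstIndex : ∀ x → ∃[ n ] enumerate n ≡ x × x ∉ˡ before n
  firstIndex x = search (suc (to⁻ x)) (subst (_∈ˡ before (suc (to⁻ x))) (to∘to⁻ x)
                   (∈-applyUpTo⁺ enumerate (ℕ.n<1+n _)))
    where
    open Surjection countable using (to⁻; to∘to⁻)
    search : ∀ n → x ∈ˡ before n → ∃[ n ] enumerate n ≡ x × x ∉ˡ before n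
    search (suc n) x∈ with em {x ∈ˡ before n}
    ... | yes x∈before = search n x∈before
    ... | no  x∉before with ∈-applyUpTo⁻ enumerate x∈
    ...   | i , i<1+n , refl with ℕ.m≤n⇒m<n∨m≡n (ℕ.≤-pred i<1+n)
    ...     | inj₁ i<n  = contradiction (∈-applyUpTo⁺ enumerate i<n) x∉before
    ...     | inj₂ refl = n , refl , x∉before

  -- One stage of the colouring: F holds the points before u, and A the distances used at earlier
  -- stages, which the new point must avoid over F so that earlier counts stay intact. `Admissible`
  -- is the reservoir of distances, chosen so that the request can be met again after any finite
  -- number of stages.
  record Rich : Set₁ where
    field
      Admissible : Pred Carrier 0ℓ
      realise    : ∀ F {u} → u ∉ˡ F → ∀ A → (∀ {α} → α ∈ˡ A → Admissible α) →
        ∃₂ λ a x → Admissible a × d x u ≈ a × x ∉ˡ u ∷ F ×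
          (∀ {f α} → f ∈ˡ F → α ∈ˡ a ∷ A → ¬ (d x f ≈ α))

  -- Stage n adds red points at a distance a from the n-th point u, one more than
  -- there are red points so far.  No red point added then or later lies at
  -- distance a from any point enumerated before u, so the number of red points
  -- at distance a tells u from its predecessors.
  module RigidColouring (rich : Rich) where

    open Rich rich

    record Stage : Set where
      field
        reds       : List Point
        used       : List Carrier
        admissible : ∀ {α} → α ∈ˡ used → Admissible α
    open Stage

    record Grown (F : List Point) (u : Point) (s s′ : Stage) : Set where
      field
        reds⊆ : ∀ {x} → x ∈ˡ reds s → x ∈ˡ reds s′
        used⊆ : ∀ {α} → α ∈ˡ used s → α ∈ˡ used s′
        apart : ∀ {x f α} → x ∈ˡ reds s′ → x ∉ˡ reds s → f ∈ˡ F → α ∈ˡ used s′ → ¬ (d x f ≈ α)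
        many  : u ∉ˡ F → ∃[ α ] α ∈ˡ used s′ × ∃[ X ] Unique X × length X ≡ suc (length (reds s)) ×
                  (∀ {x} → x ∈ˡ X → x ∈ˡ reds s′ × d x u ≈ α)

    realisations : ∀ n x F → x ∉ˡ F →
      ∃[ X ] Unique X × length X ≡ n × (∀ {x′ f} → x′ ∈ˡ X → f ∈ˡ F → d x′ f ≈ d x f)
    realisations zero    x F x∉F = [] , [] , refl , λ ()
    realisations (suc n) x F x∉F with realisations n x F x∉F
    ... | X , uniq , len , agree with freshRealisation x F X x∉F
    ...   | x′ , x′∉X , x′-agrees = x′ ∷ X ,
            All.tabulate (λ y∈X x′≡y → x′∉X (subst (_∈ˡ X) (sym x′≡y) y∈X)) ∷ uniq , cong suc len , λ where
              (here refl)  → x′-agrees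
              (there y∈X) → agree y∈X

    grow : ∀ F u s → Σ[ s′ ∈ Stage ] Grown F u s s′
    grow F u s with em {u ∈ˡ F}
    ... | yes u∈F = s , record
          { reds⊆ = λ x∈ → x∈
          ; used⊆ = λ α∈ → α∈
          ; apart = λ x∈ x∉ → contradiction x∈ x∉
          ; many  = λ u∉F → contradiction u∈F u∉F
          }
    ... | no u∉F with realise F u∉F (used s) (admissible s)
    ...   | a , x , a-admissible , xu≈a , x∉ , avoids
          with realisations (suc (length (reds s))) x (u ∷ F) x∉
    ...     | X , uniq , len , agree = s′ , record
          { reds⊆ = ∈-++⁺ʳ X
          ; used⊆ = there
          ; apart = apart
          ; many  = λ _ → a , here refl , X , uniq , len , λ x∈X →
              ∈-++⁺ˡ x∈X , ≈-trans (agree x∈X (here refl)) xu≈a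
          }
      where
      s′ = record
        { reds       = X ++ reds s
        ; used       = a ∷ used s
        ; admissible = λ where
            (here refl) → a-admissible
            (there α∈)  → admissible s α∈
        }
      apart : ∀ {y f α} → y ∈ˡ X ++ reds s → y ∉ˡ reds s → f ∈ˡ F → α ∈ˡ a ∷ used s → ¬ (d y f ≈ α)
      apart y∈ y∉ f∈F α∈ yf≈α with ∈-++⁻ X y∈
      ... | inj₁ y∈X = avoids f∈F α∈ (≈-trans (≈-sym (agree y∈X (there f∈F))) yf≈α)
      ... | inj₂ y∈s = y∉ y∈s

    stage : ℕ → Stage
    stage zero    = record { reds = [] ; used = [] ; admissible = λ () }
    stage (suc n) = proj₁ (grow (before n) (enumerate n) (stage n))

    grown : ∀ n → Grown (before n) (enumerate n) (stage n) (stage (suc n))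
    grown n = proj₂ (grow (before n) (enumerate n) (stage n))

    reds-mono : ∀ {m n x} → m ℕ.≤′ n → x ∈ˡ reds (stage m) → x ∈ˡ reds (stage n)
    reds-mono ℕ.≤′-refl           = λ x∈ → x∈
    reds-mono (ℕ.≤′-step {n} m≤n) = Grown.reds⊆ (grown n) ∘ reds-mono m≤n

    used-mono : ∀ {m n α} → m ℕ.≤′ n → α ∈ˡ used (stage m) → α ∈ˡ used (stage n)
    used-mono ℕ.≤′-refl           = λ α∈ → α∈
    used-mono (ℕ.≤′-step {n} m≤n) = Grown.used⊆ (grown n) ∘ used-mono m≤n

    before-mono : ∀ {m n x} → m ℕ.≤ n → x ∈ˡ before m → x ∈ˡ before n
    before-mono m≤n x∈ with ∈-applyUpTo⁻ enumerate x∈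
    ... | i , i<m , refl = ∈-applyUpTo⁺ enumerate (ℕ.<-≤-trans i<m m≤n)

    -- Descend through the stages: a point that turns red at a stage m ≥ j avoids α over `before m`,
    -- which contains f.
    addedEarly : ∀ n {j x f α} → x ∈ˡ reds (stage n) → f ∈ˡ before j → α ∈ˡ used (stage (suc j)) →
                 d x f ≈ α → x ∈ˡ reds (stage j)
    addedEarly (suc m) {j} {x} x∈ f∈ α∈ xf≈α with ℕ.<-≤-connex m j
    ... | inj₁ m<j = reds-mono (ℕ.≤⇒≤′ m<j) x∈
    ... | inj₂ j≤m with em {x ∈ˡ reds (stage m)}
    ...   | yes x∈m = addedEarly m x∈m f∈ α∈ xf≈α
    ...   | no  x∉m = contradiction xf≈α
            (Grown.apart (grown m) x∈ x∉m (before-mono j≤m f∈) (used-mono (ℕ.≤⇒≤′ (ℕ.s≤s j≤m)) α∈))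

    Red : Pred Point 0ℓ
    Red x = ∃[ n ] x ∈ˡ reds (stage n)

    indicator : ∀ {P : Set} → Dec P → Fin 2
    indicator (yes _) = 1F
    indicator (no _)  = 0F

    indicator-reflects : ∀ {P Q : Set} (p : Dec P) (q : Dec Q) → indicator p ≡ indicator q → P → Q
    indicator-reflects _       (yes q) _ _ = q
    indicator-reflects (no ¬p) (no _)  _ p = contradiction p ¬p

    colour : Point → Fin 2
    colour x = indicator (em {Red x})

    -- Pigeonhole: g carries the points of X injectively to red points at distance α from the image
    -- of the n-th point. If that image were older, `addedEarly` would put all of them into the red
    -- list of stage n, which is shorter by one.
    noMoveBack : ∀ g → Preserves colour g → ∀ {n} → enumerate n ∉ˡ before n → to g (enumerate n) ∉ˡ before n
    noMoveBack g preserves {n} new old with Grown.many (grown n) new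
    ... | α , α∈ , X , uniq , len , spec = ℕ.<-irrefl refl (ℕ.<-≤-trans
          (ℕ.≤-reflexive (trans (sym len) (sym (length-map (to g) X))))
          (Unique⊆⇒length≤ (Unique.map⁺ (Bijection.injective (Automorphism.bijection g)) uniq) gX⊆))
      where
      gX⊆ : ∀ {y} → y ∈ˡ map (to g) X → y ∈ˡ reds (stage n)
      gX⊆ y∈ with ∈-map⁻ (to g) y∈
      ... | x , x∈X , refl with indicator-reflects (em {Red x}) (em {Red (to g x)})
                                (sym (preserves x)) (suc n , proj₁ (spec x∈X))
      ...   | m , gx∈ = addedEarly m gx∈ old α∈
              (≈-trans (Automorphism.isometric g _ _) (proj₂ (spec x∈X)))

    -- Neither g nor its inverse moves a point to one with an earlier first occurrence.
    colour-rigid : Rigid colour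
    colour-rigid g preserves x with firstIndex x | firstIndex (to g x)
    ... | i , refl , x∉ | j , ej≡gx , gx∉ with ℕ.<-cmp i j
    ...   | tri< i<j _ _ = contradiction
            (subst (_∈ˡ before j)
              (Bijection.injective (Automorphism.bijection g)
                (trans (sym ej≡gx) (sym (proj₂ (to-surjective g (enumerate j))))))
              (∈-applyUpTo⁺ enumerate i<j))
            (noMoveBack (g ⁻¹) (Preserves-⁻¹ colour g preserves)
              (subst (_∉ˡ before j) (sym ej≡gx) gx∉))
    ...   | tri≈ _ refl _ = sym ej≡gx
    ...   | tri> _ _ j<i = contradiction
            (subst (_∈ˡ before i) ej≡gx (∈-applyUpTo⁺ enumerate j<i))
            (noMoveBack g preserves x∉)

  Rich⇒D≔2 : Rich → D U ≔ Fin 2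
  Rich⇒D≔2 rich = Rigid⇒D≔2 colour colour-rigid
    where open RigidColouring rich

  -- Spectra that supply the distances for a rigid two-colouring.

  spread⇒Rich : (Q : Pred Carrier 0ℓ) → (∀ {a} → Q a → a ∈ S × 0# < a) →
    (∀ {s} → s ∈ S → 0# < s → ∀ A → (∀ {α} → α ∈ˡ A → Q α) →
      ∃₂ λ a b → Q a × b ∈ S × a < b × b ≤ a + s × (∀ {α} → α ∈ˡ A → α < b)) →
    Rich
  spread⇒Rich Q Q⇒S⁺ spread = record { Admissible = Q ; realise = realise }
    where
    realise : ∀ F {u} → u ∉ˡ F → ∀ A → (∀ {α} → α ∈ˡ A → Q α) →
      ∃₂ λ a x → Q a × d x u ≈ a × x ∉ˡ u ∷ F ×
        (∀ {f α} → f ∈ˡ F → α ∈ˡ a ∷ A → ¬ (d x f ≈ α))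
    realise F {u} u∉F A QA with lowerBound (d u) (d∈S u) F
    ... | s , s∈S , 0<s , s≤ with spread s∈S 0<s A QA
    ...   | a , b , Qa , b∈S , a<b , b≤a+s , A<b with Q⇒S⁺ Qa
    ...     | a∈S , 0<a with atDistance u a∈S 0<a
    -- Raising the distances to F up to b needs b ≤ a + d u f, which is where b ≤ a + s enters.
    -- Since a and all used distances are below b, they are then avoided.
    ...       | x₀ , x₀u≈a with raise x₀ (u ∷ []) F b∈S (<-trans 0<a a<b) (λ where
                    (here refl) f∈F → ≤-trans b≤a+s (+-mono-≤ (≤-reflexive (≈-sym x₀u≈a))
                      (s≤ f∈F (d>0 λ where refl → u∉F f∈F))))
    ...         | x , x-agrees , b≤x = a , x , Qa , xu≈a ,
                    (λ where
                      (here refl)  → d>0⇒≢ (<-respʳ (≈-sym xu≈a) 0<a) refl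
                      (there x∈F)  → d>0⇒≢ (<-≤-trans (<-trans 0<a a<b) (b≤x x∈F)) refl) ,
                    (λ where
                      f∈F (here refl) → >⇒≉ (<-≤-trans a<b (b≤x f∈F))
                      f∈F (there α∈A) → >⇒≉ (<-≤-trans (A<b α∈A) (b≤x f∈F)))
      where
      xu≈a = ≈-trans (x-agrees (here refl)) x₀u≈a

  -- The single distance a serves at every stage: b - a is at most m, hence at most any positive
  -- distance that occurs.
  smallGap⇒Rich : ∀ {a b m} → a ∈ S → b ∈ S → 0# < a → a < b → b - a ≤ m →
                  (∀ {s} → s ∈ S → 0# < s → m ≤ s) → Rich
  smallGap⇒Rich {a} {b} a∈S b∈S 0<a a<b b-a≤m m≤ = spread⇒Rich (_≡ a)
    (λ where refl → a∈S , 0<a)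
    (λ s∈S 0<s A A≡a → a , b , refl , b∈S , a<b ,
      ≤-respʳ (+-comm _ a) (x-y≤z⇒x≤z+y (≤-trans b-a≤m (m≤ s∈S 0<s))) ,
      λ α∈A → subst (_< b) (sym (A≡a α∈A)) a<b)

  large⇒Rich : LargeElementsOfSmallDistance S → Rich
  large⇒Rich large = spread⇒Rich (λ a → a ∈ S × 0# < a) (λ Qa → Qa) spread
    where
    spread : ∀ {s} → s ∈ S → 0# < s → ∀ A → (∀ {α} → α ∈ˡ A → α ∈ S × 0# < α) →
      ∃₂ λ a b → (a ∈ S × 0# < a) × b ∈ S × a < b × b ≤ a + s × (∀ {α} → α ∈ˡ A → α < b)
    -- The pair is taken beyond N, hence beyond every used distance; the entry `1#` makes a
    -- positive.
    spread {s} _ 0<s A _ with maximumOf 1# A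
    ... | N , _ , ≤N with large N s 0<s
    ...   | a , b , a∈S , b∈S , a<b , N≤a , b-a<s = a , b ,
            (a∈S , <-≤-trans 0<1 (≤-trans (≤N (here refl)) N≤a)) , b∈S , a<b ,
            ≤-respʳ (+-comm s a) (<⇒≤ (x-y<z⇒x<z+y b-a<s)) ,
            λ α∈A → ≤-<-trans (≤-trans (≤N (there α∈A)) N≤a) a<b

  LimitFromBelow LimitFromAbove : Carrier → Set
  LimitFromBelow q = ∀ y → y < q → ∃[ s ] s ∈ S × y < s × s < q
  LimitFromAbove p = ∀ y → p < y → ∃[ s ] s ∈ S × p < s × s < y

  limitFromBelow⇒Rich : ∀ {q} → 0# < q → LimitFromBelow q → Rich
  limitFromBelow⇒Rich {q} 0<q limit = spread⇒Rich (λ a → a ∈ S × 0# < a × a < q)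
    (λ (a∈S , 0<a , _) → a∈S , 0<a) spread
    where
    spread : ∀ {s} → s ∈ S → 0# < s → ∀ A → (∀ {α} → α ∈ˡ A → α ∈ S × 0# < α × α < q) →
      ∃₂ λ a b → (a ∈ S × 0# < a × a < q) × b ∈ S × a < b × b ≤ a + s × (∀ {α} → α ∈ˡ A → α < b)
    -- Choosing a above N does three things: `0#` makes a positive, q - s gives b < q < a + s, and A
    -- puts all used distances below a.
    spread {s} _ 0<s A QA with maximumOf 0# (q - s ∷ A)
    ... | N , N∈ , ≤N with limit N (N<q N∈)
      where
      N<q : N ∈ˡ 0# ∷ q - s ∷ A → N < q
      N<q (here refl)             = 0<q
      N<q (there (here refl))     = x<z+y⇒x-y<z (x<x+y 0<s)
      N<q (there (there N∈A))     = proj₂ (proj₂ (QA N∈A))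
    ...   | a , a∈S , N<a , a<q with limit a a<q
    ...     | b , b∈S , a<b , b<q = a , b ,
              (a∈S , ≤-<-trans (≤N (here refl)) N<a , a<q) , b∈S , a<b ,
              <⇒≤ (<-trans b<q (x-y<z⇒x<z+y (≤-<-trans (≤N (there (here refl))) N<a))) ,
              λ α∈A → <-trans (≤-<-trans (≤N (there (there α∈A))) N<a) a<b

  -- Two elements e < f of S with none in between make d < f − e an equivalence
  -- relation on U: otherwise d x y, d y z < f − e ≤ d x z, and a point w with
  -- d w x = e and d w z = f would have e < d w y < f.
  module Consecutive {p e f} (0<p : 0# < p) (limit : LimitFromAbove p)
    (e∈S : e ∈ S) (f∈S : f ∈ S) (p<e : p < e) (e<f : e < f) (f<2p : f < p + p)
    (gap : ∀ {s} → s ∈ S → ¬ (e < s × s < f)) where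

    Near : Point → Point → Set
    Near x y = d x y + e < f

    0<e : 0# < e
    0<e = <-trans 0<p p<e

    near-sym : ∀ {x y} → Near x y → Near y x
    near-sym = <-respˡ (+-congʳ (d-sym _ _))

    -- Since f < p + p and p < e, the threshold f - e lies below p.
    near⇒<p : ∀ {x y} → Near x y → d x y < p
    near⇒<p near = linear-< (+-mono-< near (+-mono-< f<2p p<e))
      (solve 4 (λ a b c d → a ⊕ (b ⊕ ((c ⊕ c) ⊕ d)) ⊜ c ⊕ ((a ⊕ d) ⊕ (b ⊕ c))) ≈-refl _ _ _ _)

    near-trans : ∀ {x y z} → Near x y → Near y z → Near x z
    near-trans {x} {y} {z} xy yz with <-≤-connex (d x z + e) f
    ... | inj₁ xz = xz
    ... | inj₂ f≤xz+e with atDistance x e∈S 0<e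
    ...   | w₀ , w₀x≈e with adjust w₀ z (x ∷ []) f∈S (<-trans 0<e e<f)
              (λ where (here refl) → ≤-respʳ (≈-trans (+-comm _ e) (+-congʳ (≈-sym w₀x≈e))) f≤xz+e)
              (λ where (here refl) → ≤-trans (≤-respˡ (≈-sym w₀x≈e) (<⇒≤ e<f)) (x≤x+y 0≤d))
              (λ where (here refl) → ≤-trans (≤-trans (d-triangle x y z)
                         (+-mono-≤ (<⇒≤ (<-trans (near⇒<p xy) (<-trans p<e e<f)))
                                   (<⇒≤ (<-trans (near⇒<p yz) p<e))))
                         (+-monoʳ-≤ f (≤-reflexive (≈-sym w₀x≈e))))
    ...     | w , wz≈f , w-agrees with <-≤-connex e (d w y)
    ...       | inj₁ e<wy = contradiction (e<wy , wy<f) (gap (d∈S w y))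
      where
      wy<f : d w y < f
      wy<f = ≤-<-trans (d-triangle w x y)
        (<-respˡ (≈-trans (+-comm _ e) (+-congʳ (≈-sym (≈-trans (w-agrees (here refl)) w₀x≈e)))) xy)
    ...       | inj₂ wy≤e = contradiction
                (≤-<-trans (d-triangle w y z) (≤-<-trans (+-monoˡ-≤ _ wy≤e)
                  (<-respˡ (+-comm _ e) yz)))
                (≤⇒≯ (≤-reflexive (≈-sym wz≈f)))

    -- Used distances lie strictly between p and `e*`. The new a < b are taken below all of them;
    -- points near u get distance b, the others at least `e*`, so neither kind meets a or a used
    -- distance. The bound e* ≤ p + (f - e) is what permits raising the far points, across the gap
    -- that separates them from the near ones.
    rich : ∀ {e*} → e* ∈ S → p < e* → e* + e ≤ p + f → Rich
    rich {e*} e*∈S p<e* e*+e≤p+f = record { Admissible = Q ; realise = realise }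
      where
      Q : Pred Carrier 0ℓ
      Q α = p < α × α < e*
      near? far? : ∀ u x → Dec _
      near? u x = em {Near u x}
      far?  u x = em {¬ Near u x}
      realise : ∀ F {u} → u ∉ˡ F → ∀ A → (∀ {α} → α ∈ˡ A → Q α) →
        ∃₂ λ a x → Q a × d x u ≈ a × x ∉ˡ u ∷ F ×
          (∀ {f α} → f ∈ˡ F → α ∈ˡ a ∷ A → ¬ (d x f ≈ α))
      realise F {u} u∉F A QA with lowerBound (d u) (d∈S u) F
      -- The bounds on b: below `e*`, below every used distance, and below p + s so that b ≤ a + d u
      -- h.
      ... | s , s∈S , 0<s , s≤ with minimumOf e* (p + s ∷ A)
      ...   | N , N∈ , N≤ with limit N (p<N N∈)
        where
        p<N : N ∈ˡ e* ∷ p + s ∷ A → p < N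
        p<N (here refl)         = p<e*
        p<N (there (here refl)) = x<x+y 0<s
        p<N (there (there N∈A)) = proj₁ (QA N∈A)
      ...     | b , b∈S , p<b , b<N with limit b p<b
      ...       | a , a∈S , p<a , a<b with atDistance u a∈S (<-trans 0<p p<a)
      -- Two points near u are near each other by `near-trans`, so their distance is below p and
      -- thus within b + b.
      ...         | x₀ , x₀u≈a with assign x₀ (u ∷ []) (filter (near? u) F) b∈S (<-trans 0<p p<b)
                      (λ where (here refl) → ≤-respˡ (≈-sym x₀u≈a) (<⇒≤ a<b))
                      (λ where
                        (here refl) h∈ → <⇒≤ (<-≤-trans b<N (≤-trans (N≤ (there (here refl)))
                          (+-mono-≤ (<⇒≤ (<-respʳ (≈-sym x₀u≈a) p<a)) (s≤u (proj₁ (∈-filter⁻ (near? u) h∈)))))))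
                      (λ where
                        (here refl) h∈ → <⇒≤ (<-trans (near⇒<p (proj₂ (∈-filter⁻ (near? u) {xs = F} h∈)))
                          (<-≤-trans p<b (x≤x+y 0≤d))))
                      (λ h∈ k∈ → <⇒≤ (<-trans (near⇒<p (near-trans
                          (near-sym (proj₂ (∈-filter⁻ (near? u) {xs = F} h∈)))
                          (proj₂ (∈-filter⁻ (near? u) {xs = F} k∈))))
                        (<-trans p<b (x<x+y (<-trans 0<p p<b)))))
        where
        s≤u : ∀ {h} → h ∈ˡ F → s ≤ d u h
        s≤u h∈F = s≤ h∈F (d>0 λ where refl → u∉F h∈F)
      ...           | x₁ , x₁-agrees , x₁≈b
                      with raise x₁ (u ∷ filter (near? u) F) (filter (far? u) F) e*∈S (<-trans 0<p p<e*)
                        (λ g∈ h∈ → reach g∈ (proj₂ (∈-filter⁻ (far? u) {xs = F} h∈)))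
        where
        x₁u≈a = ≈-trans (x₁-agrees (here refl)) x₀u≈a
        -- More than p from x₁ to g and at least f - e from g to h add up to at least `e*`.
        reach′ : ∀ {g h} → p < d x₁ g → ¬ Near g h → e* ≤ d x₁ g + d g h
        reach′ p<x₁g far = linear-≤ (+-mono-≤ e*+e≤p+f (+-mono-≤ (<⇒≤ p<x₁g) (≮⇒≥ far)))
          (solve 6 (λ e* p f x g e → e* ⊕ ((p ⊕ f) ⊕ (x ⊕ (g ⊕ e))) ⊜ (x ⊕ g) ⊕ ((e* ⊕ e) ⊕ (p ⊕ f)))
            ≈-refl _ _ _ _ _ _)
        reach : ∀ {g h} → g ∈ˡ u ∷ filter (near? u) F → ¬ Near u h → e* ≤ d x₁ g + d g h
        reach (here refl) far = reach′ (<-respʳ (≈-sym x₁u≈a) p<a) far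
        reach (there g∈)  far = reach′ (<-respʳ (≈-sym (x₁≈b g∈)) p<b)
          λ near → far (near-trans (proj₂ (∈-filter⁻ (near? u) {xs = F} g∈)) near)
      ...             | x , x-agrees , e*≤x = a , x , (p<a , a<e*) , xu≈a , new , avoids
        where
        a<e* = <-trans a<b (<-≤-trans b<N (N≤ (here refl)))
        xu≈a = ≈-trans (x-agrees (here refl)) (≈-trans (x₁-agrees (here refl)) x₀u≈a)
        xf : ∀ {f} → f ∈ˡ F → d x f ≈ b ⊎ e* ≤ d x f
        xf {f} f∈F with em {Near u f}
        ... | yes near = let f∈ = ∈-filter⁺ (near? u) f∈F near in
                inj₁ (≈-trans (x-agrees (there f∈)) (x₁≈b f∈))
        ... | no  far  = inj₂ (e*≤x (∈-filter⁺ (far? u) f∈F far))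
        0<xf : ∀ {f} → f ∈ˡ F → 0# < d x f
        0<xf f∈F with xf f∈F
        ... | inj₁ xf≈b  = <-respʳ (≈-sym xf≈b) (<-trans 0<p p<b)
        ... | inj₂ e*≤xf = <-≤-trans (<-trans 0<p p<e*) e*≤xf
        new : x ∉ˡ u ∷ F
        new (here refl) = d>0⇒≢ (<-respʳ (≈-sym xu≈a) (<-trans 0<p p<a)) refl
        new (there x∈F) = d>0⇒≢ (0<xf x∈F) refl
        avoids : ∀ {f α} → f ∈ˡ F → α ∈ˡ a ∷ A → ¬ (d x f ≈ α)
        avoids f∈F α∈ xf≈α with xf f∈F
        avoids f∈F (here refl) xf≈α | inj₁ xf≈b  = <⇒≉ a<b (≈-trans (≈-sym xf≈α) xf≈b)
        avoids f∈F (there α∈A) xf≈α | inj₁ xf≈b  =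
          <⇒≉ (<-≤-trans b<N (N≤ (there (there α∈A)))) (≈-trans (≈-sym xf≈b) xf≈α)
        avoids f∈F (here refl) xf≈α | inj₂ e*≤xf = >⇒≉ (<-≤-trans a<e* e*≤xf) xf≈α
        avoids f∈F (there α∈A) xf≈α | inj₂ e*≤xf = >⇒≉ (<-≤-trans (proj₂ (QA α∈A)) e*≤xf) xf≈α

  -- Let q be the supremum of the elements of S strictly between p and f. If q is in S and below f,
  -- then q and f are consecutive, and `e*` is found within f - q above p. Otherwise the supremum is
  -- not attained, so S approaches q from below.
  limitFromAbove⇒Rich : ∀ {p} → 0# < p → LimitFromAbove p → Rich
  limitFromAbove⇒Rich {p} 0<p limit with limit (p + p) (x<x+y 0<p)
  ... | f , f∈S , p<f , f<2p = fromSupremum (complete P (proj₁ inhabited , proj₂ inhabited) (f , λ (_ , _ , s<f) → <⇒≤ s<f))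
    where
    P : Pred Carrier 0ℓ
    P s = s ∈ S × p < s × s < f
    inhabited : ∃ P
    inhabited = limit f p<f
    fromSupremum : ∃[ q ] q ∈ UpperBound P × (∀ {u} → u ∈ UpperBound P → q ≤ u) → Rich
    fromSupremum (q , upper , least) with em {q ∈ S × q < f}
    ... | yes (q∈S , q<f) with limit (p + (f - q)) (x<x+y (x<y⇒0<y-x q<f))
    ...   | e* , e*∈S , p<e* , e*<p+f-q = Consecutive.rich 0<p limit q∈S f∈S p<q q<f f<2p
              (λ s∈S (q<s , s<f) → ≤⇒≯ (upper (s∈S , <-trans p<q q<s , s<f)) q<s)
              e*∈S p<e*
              (≤-respʳ (≈-trans (+-assoc p _ q) (+-congˡ ([x-y]+y≈x f q))) (+-monoˡ-≤ q (<⇒≤ e*<p+f-q)))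
      where
      p<q : p < q
      p<q = <-≤-trans (proj₁ (proj₂ (proj₂ inhabited))) (upper (proj₂ inhabited))
    fromSupremum (q , upper , least) | no notBelow = limitFromBelow⇒Rich (<-trans 0<p p<q) approach
      where
      p<q : p < q
      p<q = <-≤-trans (proj₁ (proj₂ (proj₂ inhabited))) (upper (proj₂ inhabited))
      approach : LimitFromBelow q
      approach y y<q with em {∃[ s ] P s × y < s}
      ... | yes (s , (s∈S , p<s , s<f) , y<s) = s , s∈S , y<s ,
            ≤∧≉⇒< (upper (s∈S , p<s , s<f)) λ s≈q → notBelow (resp-≈ s≈q s∈S , <-respˡ s≈q s<f)
      ... | no ¬P>y = contradiction y<q
            (≤⇒≯ (least λ {s} Ps → ≮⇒≥ λ y<s → ¬P>y (s , Ps , y<s)))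

  positiveLimit⇒Rich : HasPositiveLimit S → Rich
  positiveLimit⇒Rich (p , 0<p , limit) with em {LimitFromBelow p}
  ... | yes below = limitFromBelow⇒Rich 0<p below
  ... | no ¬below = limitFromAbove⇒Rich 0<p above
    where
    isolated : ∃[ y₀ ] y₀ < p × (∀ {s} → s ∈ S → y₀ < s → ¬ (s < p))
    isolated with em {∃[ y₀ ] y₀ < p × (∀ {s} → s ∈ S → y₀ < s → ¬ (s < p))}
    ... | yes y₀ = y₀
    ... | no ¬y₀ = contradiction approach ¬below
      where
      approach : LimitFromBelow p
      approach y y<p with em {∃[ s ] s ∈ S × y < s × s < p}
      ... | yes s = s
      ... | no ¬s = contradiction (y , y<p , λ {s} s∈S y<s s<p → ¬s (s , s∈S , y<s , s<p)) ¬y₀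
    above : LimitFromAbove p
    above y p<y with isolated
    -- With ε at most p - y₀, an element of S within ε of p exceeds y₀ and therefore cannot lie
    -- below p.
    ... | y₀ , y₀<p , none with minimum⁺ (x<y⇒0<y-x y₀<p) (x<y⇒0<y-x p<y)
    ...   | ε , 0<ε , ε≤p-y₀ , ε≤y-p with limit ε 0<ε
    ...     | s , s∈S , s≉p , p-ε<s , s<p+ε with compare s p
    ...       | tri< s<p _ _ = contradiction s<p (none s∈S (linear-<
                  (+-mono-≤-< (+-monoˡ-≤ y₀ ε≤p-y₀) (<-respˡ (≈-sym ([x-y]+y≈x p y₀)) (x-y<z⇒x<z+y p-ε<s)))
                  (solve 4 (λ y₀ q s ε → y₀ ⊕ ((q ⊕ y₀) ⊕ (s ⊕ ε)) ⊜ s ⊕ ((ε ⊕ y₀) ⊕ (q ⊕ y₀))) ≈-refl _ _ _ _)))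
    ...       | tri≈ _ s≈p _ = contradiction s≈p s≉p
    ...       | tri> _ _ p<s = s , s∈S , p<s , <-≤-trans s<p+ε
                  (≤-trans (+-monoʳ-≤ p ε≤y-p) (≤-reflexive (≈-trans (+-comm p _) ([x-y]+y≈x y p))))

  -- Infinite distinguishing number: the upper bound and the form of the lower bound.

  Blurred : Set₁
  Blurred = ∀ {K : Set} (c : Point → K) → Rigid c → ℕ ↣ K

  -- Cells must be nonempty, while the enumeration may repeat points. Numbering a point by how many
  -- distinct points precede its first occurrence yields a bijection with ℕ, because U is infinite.
  module Ranking where

    New : ℕ → Set
    New n = enumerate n ∉ˡ before n

    rank : ℕ → ℕ
    rank zero    = zero
    rank (suc n) with em {New n}
    ... | yes _ = suc (rank n)
    ... | no  _ = rank n

    rank-suc : ∀ {n} → New n → rank (suc n) ≡ suc (rank n)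
    rank-suc {n} new with em {New n}
    ... | yes _   = refl
    ... | no ¬new = contradiction new ¬new

    rank≤rank-suc : ∀ n → rank n ℕ.≤ rank (suc n)
    rank≤rank-suc n with em {New n}
    ... | yes _ = ℕ.n≤1+n _
    ... | no  _ = ℕ.≤-refl

    rank-mono : ∀ {m n} → m ℕ.≤′ n → rank m ℕ.≤ rank n
    rank-mono ℕ.≤′-refl           = ℕ.≤-refl
    rank-mono (ℕ.≤′-step {n} m≤n) = ℕ.≤-trans (rank-mono m≤n) (rank≤rank-suc n)

    rank-strict : ∀ {m n} → New m → m ℕ.< n → rank m ℕ.< rank n
    rank-strict new m<n = ℕ.≤-trans (ℕ.≤-reflexive (sym (rank-suc new))) (rank-mono (ℕ.≤⇒≤′ m<n))

    rank-injective : ∀ {m n} → New m → New n → rank m ≡ rank n → m ≡ n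
    rank-injective {m} {n} new-m new-n eq with ℕ.<-cmp m n
    ... | tri< m<n _ _ = contradiction eq (ℕ.<⇒≢ (rank-strict new-m m<n))
    ... | tri≈ _ m≡n _ = m≡n
    ... | tri> _ _ n<m = contradiction (sym eq) (ℕ.<⇒≢ (rank-strict new-n n<m))

    rank-hits : ∀ k N → k ℕ.< rank N → ∃[ n ] New n × rank n ≡ k
    rank-hits k (suc N) k< with em {New N}
    ... | no  _   = rank-hits k N k<
    ... | yes new with ℕ.m≤n⇒m<n∨m≡n (ℕ.≤-pred k<)
    ...   | inj₁ k<rank = rank-hits k N k<rank
    ...   | inj₂ k≡rank = N , new , sym k≡rank

    rank-unbounded : ∀ k → ∃[ N ] k ℕ.≤ rank N
    rank-unbounded zero    = zero , ℕ.z≤n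
    rank-unbounded (suc k) with rank-unbounded k
    ... | N , k≤rank with freshPoint (before N)
    ...   | x , x∉ with firstIndex x
    ...     | n , refl , new with ℕ.<-≤-connex n N
    ...       | inj₁ n<N = contradiction (∈-applyUpTo⁺ enumerate n<N) x∉
    ...       | inj₂ N≤n = suc n , ℕ.≤-trans (ℕ.s≤s (ℕ.≤-trans k≤rank (rank-mono (ℕ.≤⇒≤′ N≤n))))
                  (ℕ.≤-reflexive (sym (rank-suc new)))

    cellOf : Point → ℕ
    cellOf x = rank (proj₁ (firstIndex x))

    cellOf-injective : ∀ {x y} → cellOf x ≡ cellOf y → x ≡ y
    cellOf-injective {x} {y} eq with firstIndex x | firstIndex y
    ... | m , refl , new-m | n , refl , new-n = cong enumerate (rank-injective new-m new-n eq)

    rank≡cellOf : ∀ {n} → New n → cellOf (enumerate n) ≡ rank n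
    rank≡cellOf {n} new with firstIndex (enumerate n)
    ... | m , eq , new-m with ℕ.<-cmp m n
    ...   | tri< m<n _ _ = contradiction (subst (_∈ˡ before n) eq (∈-applyUpTo⁺ enumerate m<n)) new
    ...   | tri≈ _ m≡n _ = cong rank m≡n
    ...   | tri> _ _ n<m = contradiction (∈-applyUpTo⁺ enumerate n<m) new-m

    cellOf-surjective : StrictlySurjective _≡_ cellOf
    cellOf-surjective k with rank-unbounded (suc k)
    ... | N , k<rank with rank-hits k N k<rank
    ...   | n , new , eq = enumerate n , trans (rank≡cellOf new) eq

  Blurred⇒D≔ℕ : Blurred → D U ≔ ℕ
  Blurred⇒D≔ℕ blurred = record
    { attained = Rigid⇒distinguishing cellOf cellOf-surjective (λ g preserves x → cellOf-injective (preserves x))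
    ; least    = λ K P → blurred (DistinguishingPartition.cellOf P) (distinguishing⇒Rigid P)
    }
    where open Ranking

  Blurred⇒¬D≔2 : Blurred → ¬ (D U ≔ Fin 2)
  Blurred⇒¬D≔2 blurred D≔2 = ¬ℕ↣Fin2 (blurred cellOf (distinguishing⇒Rigid (D_≔_.attained D≔2)))
    where
    open DistinguishingPartition (D_≔_.attained D≔2) using (cellOf)
    ¬ℕ↣Fin2 : ¬ (ℕ ↣ Fin 2)
    ¬ℕ↣Fin2 f with injective⇒≤ {m = 3} {f = λ i → Injection.to f (toℕ i)} (λ eq → toℕ-injective (Injection.injective f eq))
    ... | ℕ.s≤s (ℕ.s≤s ())

  -- Infinite sequences, automorphisms given by relations, and transpositions.

  freshSequence : ∀ {A : Set} (Inv : List A → Set) (R : A → A → Set) → Inv [] →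
    (∀ {ℓ} → Inv ℓ → ∃[ x ] Inv (x ∷ ℓ) × (∀ {y} → y ∈ˡ ℓ → R x y)) →
    Σ[ f ∈ (ℕ → A) ] (∀ {i j} → i ℕ.< j → R (f j) (f i))
  freshSequence {A} Inv R inv-[] extend =
    term , λ {i} {j} i<j → proj₂ (proj₂ (extend (proj₂ (terms j)))) (term∈ (ℕ.≤⇒≤′ i<j))
    where
    terms : ℕ → Σ (List A) Inv
    terms zero    = [] , inv-[]
    terms (suc n) = let x , inv , _ = extend (proj₂ (terms n)) in x ∷ proj₁ (terms n) , inv
    term : ℕ → A
    term n = proj₁ (extend (proj₂ (terms n)))
    term∈ : ∀ {i j} → suc i ℕ.≤′ j → term i ∈ˡ proj₁ (terms j)
    term∈ ℕ.≤′-refl       = here refl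
    term∈ (ℕ.≤′-step i<j) = there (term∈ i<j)

  differentColours⇒↣ : ∀ {K : Set} (c : Point → K) →
    Σ[ f ∈ (ℕ → Point) ] (∀ {i j} → i ℕ.< j → c (f j) ≢ c (f i)) → ℕ ↣ K
  differentColours⇒↣ c (f , differ) = mk↣ {to = λ n → c (f n)} λ {i} {j} eq → injective i j eq
    where
    injective : ∀ i j → c (f i) ≡ c (f j) → i ≡ j
    injective i j eq with ℕ.<-cmp i j
    ... | tri< i<j _ _ = contradiction (sym eq) (differ i<j)
    ... | tri≈ _ i≡j _ = i≡j
    ... | tri> _ _ j<i = contradiction eq (differ j<i)

  -- An isometric relation is automatically the graph of an injection: T x y and T x z give d y z =
  -- d x x = 0, and symmetrically for preimages.
  fromRelation : (T : Point → Point → Set) → (∀ x → ∃[ x′ ] T x x′) → (∀ x′ → ∃[ x ] T x x′) →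
    (∀ {x x′ y y′} → T x x′ → T y y′ → d x y ≈ d x′ y′) →
    Σ[ g ∈ Automorphism U ] (∀ x → T x (to g x))
  fromRelation T total surj iso = record
    { bijection = mk⤖ {to = f} (injective , λ y → let x , Txy = surj y in
        x , λ where refl → functional (Tf x) Txy)
    ; isometric = λ x y → ≈-sym (iso (Tf x) (Tf y))
    } , Tf
    where
    f : Point → Point
    f x = proj₁ (total x)
    Tf : ∀ x → T x (f x)
    Tf x = proj₂ (total x)
    functional : ∀ {x y z} → T x y → T x z → y ≡ z
    functional Txy Txz = d≈0⇒≡ (≈-trans (≈-sym (iso Txy Txz)) (d-refl _))
    injective : ∀ {x y} → f x ≡ f y → x ≡ y
    injective {x} {y} eq = d≈0⇒≡ (≈-trans (iso (Tf x) (Tf y)) (≡⇒d≈0 eq))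

  -- The distances of a third point to x and y differ by at most d x y = m, so the gaps force them
  -- to be equal and the transposition of x and y is an isometry. In a rigid colouring, points at
  -- distance m therefore differ in colour, and there is an infinite set of points with all mutual
  -- distances m.
  gaps⇒Blurred : ∀ {m} → IsLeastPositive S m →
    (∀ {a b} → a ∈ S → b ∈ S → 0# < a → a < b → a + m < b) → Blurred
  gaps⇒Blurred {m} (m∈S , 0<m , m≤) gap c rigid with em {∃₂ λ x y → d x y ≈ m × c x ≡ c y}
  ... | yes (x , y , xy≈m , cx≡cy) = contradiction (swapped (proj₂ transposition x)) λ swaps → x≢y (trans (sym (rigid
          (proj₁ transposition) (λ w → sym (T⇒sameColour (proj₂ transposition w))) x)) swaps)
    where
    x≢y : x ≢ y
    x≢y = d>0⇒≢ (<-respʳ (≈-sym xy≈m) 0<m)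
    T : Point → Point → Set
    T w w′ = (w ≡ x × w′ ≡ y) ⊎ (w ≡ y × w′ ≡ x) ⊎ (w ≢ x × w ≢ y × w ≡ w′)
    total : ∀ w → ∃[ w′ ] T w w′
    total w with em {w ≡ x} | em {w ≡ y}
    ... | yes w≡x | _       = y , inj₁ (w≡x , refl)
    ... | no  _   | yes w≡y = x , inj₂ (inj₁ (w≡y , refl))
    ... | no  w≢x | no  w≢y = w , inj₂ (inj₂ (w≢x , w≢y , refl))
    T-sym : ∀ {w w′} → T w w′ → T w′ w
    T-sym (inj₁ (w≡x , w′≡y))               = inj₂ (inj₁ (w′≡y , w≡x))
    T-sym (inj₂ (inj₁ (w≡y , w′≡x)))        = inj₁ (w′≡x , w≡y)
    T-sym (inj₂ (inj₂ (w≢x , w≢y , refl)))  = inj₂ (inj₂ (w≢x , w≢y , refl))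
    equidistant : ∀ {w} → w ≢ x → w ≢ y → d x w ≈ d y w
    equidistant {w} w≢x w≢y with compare (d x w) (d y w)
    ... | tri< xw<yw _ _ = contradiction (gap (d∈S x w) (d∈S y w) (d>0 (w≢x ∘ sym)) xw<yw)
            (≤⇒≯ (≤-trans (d-triangleˡ y x w) (≤-respʳ (+-comm m _) (+-monoˡ-≤ _ (≤-reflexive xy≈m)))))
    ... | tri≈ _ xw≈yw _ = xw≈yw
    ... | tri> _ _ yw<xw = contradiction (gap (d∈S y w) (d∈S x w) (d>0 (w≢y ∘ sym)) yw<xw)
            (≤⇒≯ (≤-trans (d-triangle x y w) (≤-respʳ (+-comm m _) (+-monoˡ-≤ _ (≤-reflexive xy≈m)))))
    equidistant′ : ∀ {w} → w ≢ x → w ≢ y → d w x ≈ d w y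
    equidistant′ w≢x w≢y = ≈-trans (d-sym _ x) (≈-trans (equidistant w≢x w≢y) (d-sym y _))
    iso : ∀ {w w′ z z′} → T w w′ → T z z′ → d w z ≈ d w′ z′
    iso (inj₁ (refl , refl))               (inj₁ (refl , refl))               = ≈-trans (d-refl _) (≈-sym (d-refl _))
    iso (inj₁ (refl , refl))               (inj₂ (inj₁ (refl , refl)))        = d-sym _ _
    iso (inj₁ (refl , refl))               (inj₂ (inj₂ (z≢x , z≢y , refl)))   = equidistant z≢x z≢y
    iso (inj₂ (inj₁ (refl , refl)))        (inj₁ (refl , refl))               = d-sym _ _
    iso (inj₂ (inj₁ (refl , refl)))        (inj₂ (inj₁ (refl , refl)))        = ≈-trans (d-refl _) (≈-sym (d-refl _))
    iso (inj₂ (inj₁ (refl , refl)))        (inj₂ (inj₂ (z≢x , z≢y , refl)))   = ≈-sym (equidistant z≢x z≢y)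
    iso (inj₂ (inj₂ (w≢x , w≢y , refl)))   (inj₁ (refl , refl))               = equidistant′ w≢x w≢y
    iso (inj₂ (inj₂ (w≢x , w≢y , refl)))   (inj₂ (inj₁ (refl , refl)))        = ≈-sym (equidistant′ w≢x w≢y)
    iso (inj₂ (inj₂ (_ , _ , refl)))       (inj₂ (inj₂ (_ , _ , refl)))       = ≈-refl
    transposition = fromRelation T total (λ w → let w′ , Tww′ = total w in w′ , T-sym Tww′) iso
    T⇒sameColour : ∀ {w w′} → T w w′ → c w ≡ c w′
    T⇒sameColour (inj₁ (refl , refl))             = cx≡cy
    T⇒sameColour (inj₂ (inj₁ (refl , refl)))      = sym cx≡cy
    T⇒sameColour (inj₂ (inj₂ (_ , _ , refl)))     = refl
    swapped : ∀ {w} → T x w → w ≡ y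
    swapped (inj₁ (_ , w≡y))               = w≡y
    swapped (inj₂ (inj₁ (x≡y , _)))        = contradiction x≡y x≢y
    swapped (inj₂ (inj₂ (x≢x , _ , _)))    = contradiction refl x≢x
  ... | no noPair = differentColours⇒↣ c (proj₁ sequence , λ i<j eq →
          noPair (_ , _ , proj₂ sequence i<j , eq))
    where
    -- Diameter at most m + m is exactly what `assign` requires to place a point at distance m from
    -- the whole list.
    Inv : List Point → Set
    Inv ℓ = ∀ {x y} → x ∈ˡ ℓ → y ∈ˡ ℓ → d x y ≤ m + m
    0≤2m : 0# ≤ m + m
    0≤2m = <⇒≤ (+-pos 0<m 0<m)
    m≤2m : m ≤ m + m
    m≤2m = x≤x+y (<⇒≤ 0<m)
    extend : ∀ {ℓ} → Inv ℓ → ∃[ x ] Inv (x ∷ ℓ) × (∀ {y} → y ∈ˡ ℓ → d x y ≈ m)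
    extend {ℓ} inv with assign point [] ℓ m∈S 0<m (λ ()) (λ ()) (λ ()) inv
    ... | x , _ , x≈m = x , (λ where
          (here refl) (here refl) → ≤-trans (≤-reflexive (d-refl x)) 0≤2m
          (here refl) (there y∈)  → ≤-trans (≤-reflexive (x≈m y∈)) m≤2m
          (there y∈)  (here refl) → ≤-trans (≤-reflexive (≈-trans (d-sym _ x) (x≈m y∈))) m≤2m
          (there y∈)  (there z∈)  → inv y∈ z∈) , x≈m
    sequence = freshSequence Inv (λ x y → d x y ≈ m) (λ ()) extend

  -- Zero as the only limit: back-and-forth by small moves.

  module BackAndForth (Inv : List (Point × Point) → Set)
    (Inv⇒isometry : ∀ {L} → Inv L → PartialIsometry L)
    (forth : ∀ {L} → Inv L → ∀ x → ∃[ x′ ] Inv ((x , x′) ∷ L))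
    (back  : ∀ {L} → Inv L → ∀ x′ → ∃[ x ] Inv ((x , x′) ∷ L))
    {L₀ : List (Point × Point)} (inv₀ : Inv L₀) where

    stages : ℕ → Σ (List (Point × Point)) Inv
    stages zero    = L₀ , inv₀
    stages (suc n) =
      let _ , inv₁ = forth (proj₂ (stages n)) (enumerate n)
          _ , inv₂ = back inv₁ (enumerate n)
      in _ , inv₂

    stages-mono : ∀ {m n p} → m ℕ.≤′ n → p ∈ˡ proj₁ (stages m) → p ∈ˡ proj₁ (stages n)
    stages-mono ℕ.≤′-refl       p∈ = p∈
    stages-mono (ℕ.≤′-step m≤n) p∈ = there (there (stages-mono m≤n p∈))

    Related : Point → Point → Set
    Related x x′ = ∃[ n ] (x , x′) ∈ˡ proj₁ (stages n)

    Related-isometry : ∀ {x x′ y y′} → Related x x′ → Related y y′ → d x y ≈ d x′ y′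
    Related-isometry (m , xx′∈) (n , yy′∈) = Inv⇒isometry (proj₂ (stages (m ℕ.⊔ n)))
      (stages-mono (ℕ.≤⇒≤′ (ℕ.m≤m⊔n m n)) xx′∈) (stages-mono (ℕ.≤⇒≤′ (ℕ.m≤n⊔m m n)) yy′∈)

    automorphism : Σ[ g ∈ Automorphism U ] (∀ x → Related x (to g x))
    automorphism = fromRelation Related
      (λ x → subst (λ y → ∃[ x′ ] Related y x′) (to∘to⁻ x) (_ , suc (to⁻ x) , there (here refl)))
      (λ x′ → subst (λ y → ∃[ x ] Related x y) (to∘to⁻ x′) (_ , suc (to⁻ x′) , here refl))
      Related-isometry
      where open Surjection countable using (to⁻; to∘to⁻)

  module SmallDisplacement (¬positiveLimit : ¬ HasPositiveLimit S) (zeroLimit : IsLimit S 0#)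
    {N ε} (0<ε : 0# < ε) (gap : ∀ {a b} → a ∈ S → b ∈ S → a < b → N ≤ a → a + ε ≤ b) where

    GapAbove : Carrier → Carrier → Set
    GapAbove δ ρ = ∀ {a b} → a ∈ S → b ∈ S → δ ≤ a → a < b → a + ρ ≤ b

    GapBetween : Carrier → Pred Carrier 0ℓ
    GapBetween δ t = ∃[ ρ ] 0# < ρ × (∀ {a b} → a ∈ S → b ∈ S → δ ≤ a → a < t → a < b → a + ρ ≤ b)

    -- Otherwise the supremum of the t with GapBetween δ t is a positive limit.
    gapBetween : ∀ {δ} → 0# < δ → GapBetween δ N
    gapBetween {δ} 0<δ with em {GapBetween δ N}
    ... | yes found = found
    ... | no ¬found = contradiction (q , 0<q , isLimit) ¬positiveLimit
      where
      δ-between : GapBetween δ δ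
      δ-between = 1# , 0<1 , λ _ _ δ≤a a<δ → contradiction a<δ (≤⇒≯ δ≤a)
      bounded : N ∈ UpperBound (GapBetween δ)
      bounded (ρ , 0<ρ , gapₜ) = ≮⇒≥ λ N<t → ¬found (ρ , 0<ρ ,
        λ a∈S b∈S δ≤a a<N → gapₜ a∈S b∈S δ≤a (<-trans a<N N<t))
      supremum = complete (GapBetween δ) (δ , δ-between) (N , bounded)
      q = proj₁ supremum
      upper = proj₁ (proj₂ supremum)
      least = proj₂ (proj₂ supremum)
      0<q : 0# < q
      0<q = <-≤-trans 0<δ (upper δ-between)
      isLimit : IsLimit S q
      isLimit η 0<η with em {∃[ s ] s ∈ S × ¬ (s ≈ q) × q - η < s × s < q + η}
      ... | yes s = s
      ... | no isolated with em {∃[ t ] GapBetween δ t × q - η < t}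
      ...   | no ¬t = contradiction (x<z+y⇒x-y<z (x<x+y 0<η))
              (≤⇒≯ (least λ between → ≮⇒≥ λ q-η<t → ¬t (_ , between , q-η<t)))
      ...   | yes (t , (ρ₁ , 0<ρ₁ , gap₁) , q-η<t) with minimum⁺ 0<ρ₁ 0<η
      ...     | ρ , 0<ρ , ρ≤ρ₁ , ρ≤η = contradiction (x<x+y 0<η) (≤⇒≯ (upper (ρ , 0<ρ , gap′)))
        where
        -- If q were no limit, only q itself could be an element of S within η of q. The gap known
        -- up to t, which is above q - η, would then extend to q + η, beyond the supremum.
        gap′ : ∀ {a b} → a ∈ S → b ∈ S → δ ≤ a → a < q + η → a < b → a + ρ ≤ b
        gap′ {a} {b} a∈S b∈S δ≤a a<q+η a<b with <-≤-connex a t | em {a ≈ q}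
        ... | inj₁ a<t | _       = ≤-trans (+-monoʳ-≤ a ρ≤ρ₁) (gap₁ a∈S b∈S δ≤a a<t a<b)
        ... | inj₂ t≤a | no a≉q  = contradiction (a , a∈S , a≉q , <-≤-trans q-η<t t≤a , a<q+η) isolated
        ... | inj₂ t≤a | yes a≈q = ≤-trans (+-mono-≤ (≤-reflexive a≈q) ρ≤η) (≮⇒≥ λ b<q+η →
              isolated (b , b∈S , >⇒≉ (<-respˡ a≈q a<b) , <-trans (<-≤-trans q-η<t t≤a) a<b , b<q+η))

    -- Between δ and N the bound comes from the absence of positive limits, from N on from the
    -- hypothesis `gap`.
    uniformGap : ∀ {δ} → 0# < δ → ∃[ ρ ] 0# < ρ × GapAbove δ ρ
    uniformGap {δ} 0<δ with gapBetween 0<δ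
    ... | ρ₁ , 0<ρ₁ , gap₁ with minimum⁺ 0<ρ₁ 0<ε
    ...   | ρ , 0<ρ , ρ≤ρ₁ , ρ≤ε = ρ , 0<ρ , gap′
      where
      gap′ : GapAbove δ ρ
      gap′ {a} a∈S b∈S δ≤a a<b with <-≤-connex a N
      ... | inj₁ a<N = ≤-trans (+-monoʳ-≤ a ρ≤ρ₁) (gap₁ a∈S b∈S δ≤a a<N a<b)
      ... | inj₂ N≤a = ≤-trans (+-monoʳ-≤ a ρ≤ε) (gap a∈S b∈S a<b N≤a)

    close⇒≈ : ∀ {δ ρ s t} → GapAbove δ ρ → s ∈ S → t ∈ S → δ ≤ s → δ ≤ t → s < t + ρ → t < s + ρ → s ≈ t
    close⇒≈ {s = s} {t} gapρ s∈S t∈S δ≤s δ≤t s<t+ρ t<s+ρ with compare s t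
    ... | tri< s<t _ _ = contradiction t<s+ρ (≤⇒≯ (gapρ s∈S t∈S δ≤s s<t))
    ... | tri≈ _ s≈t _ = s≈t
    ... | tri> _ _ t<s = contradiction s<t+ρ (≤⇒≯ (gapρ t∈S s∈S δ≤t t<s))

    -- For w close to z, the distances d w g and d z g differ by less than a gap of S, so they
    -- agree. Half of the least positive d z g is the threshold for the gaps, because it still
    -- bounds d w g from below.
    locallyConstant : ∀ z F → ∃[ η ] 0# < η ×
      (∀ {w} → d z w < η → ∀ {g} → g ∈ˡ F → g ≢ z → d w g ≈ d z g)
    locallyConstant z F with lowerBound (d z) (d∈S z) F
    ... | μ , _ , 0<μ , μ≤ with half 0<μ
    ...   | h , 0<h , h+h≈μ with uniformGap 0<h
    ...     | ρ , 0<ρ , gapρ with minimum⁺ 0<ρ 0<h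
    ...       | η , 0<η , η≤ρ , η≤h = η , 0<η , constant
      where
      constant : ∀ {w} → d z w < η → ∀ {g} → g ∈ˡ F → g ≢ z → d w g ≈ d z g
      constant {w} zw<η {g} g∈F g≢z = close⇒≈ gapρ (d∈S w g) (d∈S z g) h≤wg
        (≤-trans (x≤x+y (<⇒≤ 0<h)) h+h≤zg)
        (≤-<-trans (d-triangleˡ w z g) (<-respʳ (+-comm ρ _) (+-monoˡ-< _ (<-≤-trans zw<η η≤ρ))))
        (≤-<-trans (d-triangle z w g) (<-respʳ (+-comm ρ _) (+-monoˡ-< _ (<-≤-trans zw<η η≤ρ))))
        where
        h+h≤zg : h + h ≤ d z g
        h+h≤zg = ≤-respˡ (≈-sym h+h≈μ) (μ≤ g∈F (d>0 (g≢z ∘ sym)))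
        h≤wg : h ≤ d w g
        h≤wg = linear-≤ (≤-trans h+h≤zg (≤-trans (d-triangle z w g)
                 (+-monoˡ-≤ _ (≤-trans (<⇒≤ zw<η) η≤h))))
               (solve 2 (λ h w → h ⊕ (h ⊕ w) ⊜ w ⊕ (h ⊕ h)) ≈-refl _ _)

    module _ {K : Set} (c : Point → K) where

      HomogeneousBall : Point → Carrier → Set
      HomogeneousBall v ρ = 0# < ρ × (∀ {w y η} → d v w < ρ → d v y < ρ → 0# < η →
                              ∃[ w′ ] d w w′ < η × c w′ ≡ c y)

      -- Induction on the number of available colours. If the colour of y is missing near w, a
      -- smaller ball around w inside the given one omits that colour, and the list of colours
      -- shrinks.
      homogeneousBall : ∀ n v {ρ} → 0# < ρ → (ℓ : List K) → length ℓ ℕ.< n →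
        (∀ {y} → d v y < ρ → c y ∈ˡ ℓ) → ∃₂ HomogeneousBall
      homogeneousBall (suc n) v {ρ} 0<ρ ℓ ℓ<n covers
        with em {∃[ w ] ∃[ y ] ∃[ η ] d v w < ρ × d v y < ρ × 0# < η × (∀ {w′} → d w w′ < η → c w′ ≢ c y)}
      ... | no ¬missing = v , ρ , 0<ρ , dense
        where
        dense : ∀ {w y η} → d v w < ρ → d v y < ρ → 0# < η → ∃[ w′ ] d w w′ < η × c w′ ≡ c y
        dense {w} {y} {η} vw<ρ vy<ρ 0<η with em {∃[ w′ ] d w w′ < η × c w′ ≡ c y}
        ... | yes found = found
        ... | no ¬found = contradiction
                (w , y , η , vw<ρ , vy<ρ , 0<η , λ {w′} ww′<η eq → ¬found (w′ , ww′<η , eq)) ¬missing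
      ... | yes (w , y , η , vw<ρ , vy<ρ , 0<η , missing) with minimum⁺ 0<η (x<y⇒0<y-x vw<ρ)
      ...   | σ , 0<σ , σ≤η , σ≤ρ-vw = homogeneousBall n w 0<σ
              (filter ≢cy? ℓ)
              (ℕ.<-≤-trans (filter-notAll ≢cy? ℓ (Any.map (λ cy≡k neq → neq (sym cy≡k)) (covers vy<ρ))) (ℕ.≤-pred ℓ<n))
              (λ ww′<σ → ∈-filter⁺ ≢cy? (covers (≤-<-trans (d-triangle v w _) (inside ww′<σ)))
                (missing (<-≤-trans ww′<σ σ≤η)))
        where
        ≢cy? : ∀ k → Dec (k ≢ c y)
        ≢cy? k = em
        inside : ∀ {t} → t < σ → d v w + t < ρ
        inside t<σ = <-respʳ (≈-trans (+-comm _ _) ([x-y]+y≈x ρ (d v w)))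
          (+-monoʳ-< _ (<-≤-trans t<σ σ≤ρ-vw))

      module _ {v ρ} (ball : HomogeneousBall v ρ) where

        private
          0<ρ = proj₁ ball
          dense = proj₂ ball

        V : Pred Point 0ℓ
        V y = d v y < ρ

        -- A point of V within h = ρ/2 of v is at least h from the outside. For any other y in V and
        -- any x outside, d v y ≥ h and d v x > d v y, so these two differ by at least a gap of S.
        separation : ∃[ δ ] 0# < δ × (∀ {x y} → ¬ V x → V y → δ ≤ d x y)
        separation with half 0<ρ
        ... | h , 0<h , h+h≈ρ with uniformGap 0<h
        ...   | γ , 0<γ , gapγ with minimum⁺ 0<γ 0<h
        ...     | δ , 0<δ , δ≤γ , δ≤h = δ , 0<δ , separated
          where
          separated : ∀ {x y} → ¬ V x → V y → δ ≤ d x y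
          separated {x} {y} ¬Vx Vy with <-≤-connex (d v y) h
          ... | inj₁ vy<h = ≤-trans δ≤h (linear-≤ (≤-trans (≤-reflexive h+h≈ρ) (≤-trans (≮⇒≥ ¬Vx)
                  (≤-trans (d-triangleʳ v y x) (+-monoˡ-≤ _ (<⇒≤ vy<h)))))
                (solve 2 (λ h x → h ⊕ (h ⊕ x) ⊜ x ⊕ (h ⊕ h)) ≈-refl _ _))
          ... | inj₂ h≤vy = ≤-trans δ≤γ (linear-≤ (≤-trans
                  (gapγ (d∈S v y) (d∈S v x) h≤vy (<-≤-trans Vy (≮⇒≥ ¬Vx))) (d-triangleʳ v y x))
                (solve 3 (λ g y x → g ⊕ (y ⊕ x) ⊜ x ⊕ (y ⊕ g)) ≈-refl _ _ _))

        -- Moving by less than the separation does not leave V, and moving by less than a gap above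
        -- the separation cannot change a distance to an outside point. As 0 is a limit, S contains
        -- such a positive r.
        smallStep : ∃[ r ] r ∈ S × 0# < r ×
          (∀ {y y′} → V y → d y y′ ≤ r → V y′ × (∀ {x} → ¬ V x → d x y ≈ d x y′))
        smallStep with separation
        ... | δ , 0<δ , separated with uniformGap 0<δ
        ...   | γ , 0<γ , gapγ with minimum⁺ 0<γ 0<δ
        ...     | η , 0<η , η≤γ , η≤δ with zeroLimit η 0<η
        ...       | r , r∈S , r≉0 , _ , r<0+η = r , r∈S , ≤∧≉⇒< (nonNegative r∈S) (r≉0 ∘ ≈-sym) ,
                  λ Vy yy′≤r → stays Vy yy′≤r , λ ¬Vx → unchanged Vy (stays Vy yy′≤r) yy′≤r ¬Vx
          where
          r<η : r < η
          r<η = <-respʳ (+-identityˡ η) r<0+η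
          stays : ∀ {y y′} → V y → d y y′ ≤ r → V y′
          stays {y} {y′} Vy yy′≤r with em {V y′}
          ... | yes Vy′ = Vy′
          ... | no ¬Vy′ = contradiction (<-≤-trans r<η η≤δ)
                (≤⇒≯ (≤-trans (separated ¬Vy′ Vy) (≤-respˡ (d-sym y y′) yy′≤r)))
          unchanged : ∀ {x y y′} → V y → V y′ → d y y′ ≤ r → ¬ V x → d x y ≈ d x y′
          unchanged {x} {y} {y′} Vy Vy′ yy′≤r ¬Vx =
            close⇒≈ gapγ (d∈S x y) (d∈S x y′) (separated ¬Vx Vy) (separated ¬Vx Vy′)
              (≤-<-trans (d-triangleʳ x y′ y) (+-monoʳ-< _ yy′<γ))
              (≤-<-trans (d-triangle x y y′) (+-monoʳ-< _ yy′<γ))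
            where yy′<γ = ≤-<-trans yy′≤r (<-≤-trans r<η η≤γ)

        module Move {r} (r∈S : r ∈ S) (0<r : 0# < r)
          (step : ∀ {y y′} → V y → d y y′ ≤ r → V y′ × (∀ {x} → ¬ V x → d x y ≈ d x y′)) where

          Moved : Point → Point → Set
          Moved y y′ = c y ≡ c y′ × (¬ V y × y ≡ y′ ⊎ V y × V y′ × d y y′ ≤ r)

          Moved-sym : ∀ {y y′} → Moved y y′ → Moved y′ y
          Moved-sym (cy≡cy′ , inj₁ (¬Vy , refl))       = sym cy≡cy′ , inj₁ (¬Vy , refl)
          Moved-sym (cy≡cy′ , inj₂ (Vy , Vy′ , yy′≤r)) =
            sym cy≡cy′ , inj₂ (Vy′ , Vy , ≤-respˡ (d-sym _ _) yy′≤r)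

          displacement : ∀ {y y′} → Moved y y′ → d y y′ ≤ r
          displacement (_ , inj₁ (_ , refl))       = ≤-trans (≤-reflexive (d-refl _)) (<⇒≤ 0<r)
          displacement (_ , inj₂ (_ , _ , yy′≤r))  = yy′≤r

          record Inv (L : List (Point × Point)) : Set where
            field
              moved    : ∀ {y y′} → (y , y′) ∈ˡ L → Moved y y′
              isometry : PartialIsometry L
          open Inv

          extend : ∀ {L y y′} → Inv L → Moved y y′ →
                   (∀ {x x′} → (x , x′) ∈ˡ L → d y x ≈ d y′ x′) → Inv ((y , y′) ∷ L)
          extend inv m iso .moved (here refl) = m
          extend inv m iso .moved (there p∈)  = moved inv p∈
          extend inv m iso .isometry (here refl) (here refl) = ≈-trans (d-refl _) (≈-sym (d-refl _))
          extend inv m iso .isometry (here refl) (there q∈)  = iso q∈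
          extend inv m iso .isometry (there p∈)  (here refl) = ≈-trans (d-sym _ _) (≈-trans (iso p∈) (d-sym _ _))
          extend inv m iso .isometry (there p∈)  (there q∈)  = isometry inv p∈ q∈

          flip : ∀ {L} → Inv L → Inv (map swap L)
          flip inv .moved p∈ with ∈-map⁻ swap p∈
          ... | _ , p∈L , refl = Moved-sym (moved inv p∈L)
          flip inv .isometry p∈ q∈ with ∈-map⁻ swap p∈ | ∈-map⁻ swap q∈
          ... | _ , p∈L , refl | _ , q∈L , refl = ≈-sym (isometry inv p∈L q∈L)

          -- An automorphism extending L sends y to a point z with the right distances, possibly far
          -- from y. In that case z is replaced by a point at distance r from y: each x is at most r
          -- from its partner x′, so d y x and d y x′ differ by at most r, which gives the triangle
          -- inequalities.
          nearbyImage : ∀ {L} → Inv L → ∀ y →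
            ∃[ z ] d z y ≤ r × (∀ {x x′} → (x , x′) ∈ˡ L → d z x′ ≈ d y x)
          nearbyImage {L} inv y with extendPartialIsometry L (isometry inv)
          ... | g , g-extends with <-≤-connex r (d (to g y) y)
          ...   | inj₂ zy≤r = to g y , zy≤r , agrees
            where
            agrees : ∀ {x x′} → (x , x′) ∈ˡ L → d (to g y) x′ ≈ d y x
            agrees p∈ = subst (λ x′ → d (to g y) x′ ≈ _) (g-extends p∈) (Automorphism.isometric g y _)
          ...   | inj₁ r<zy = result
            where
            z = to g y
            agrees : ∀ {x x′} → (x , x′) ∈ˡ L → d z x′ ≈ d y x
            agrees p∈ = subst (λ x′ → d z x′ ≈ _) (g-extends p∈) (Automorphism.isometric g y _)
            F = map proj₂ L
            r≤ : ∀ {x′} → x′ ∈ˡ F → r ≤ d z x′ + d x′ y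
            r≤ _ = ≤-trans (<⇒≤ r<zy) (d-triangle _ _ _)
            zx′≤ : ∀ {x′} → x′ ∈ˡ F → d z x′ ≤ r + d x′ y
            zx′≤ x′∈ with ∈-map⁻ proj₂ x′∈
            ... | (x , x′) , p∈ , refl = ≤-trans (≤-reflexive (agrees p∈)) (≤-trans (d-triangle y x′ x)
                  (≤-respʳ (+-comm _ r) (+-mono-≤ (≤-reflexive (d-sym y x′))
                    (≤-respˡ (d-sym x x′) (displacement (moved inv p∈))))))
            x′y≤ : ∀ {x′} → x′ ∈ˡ F → d x′ y ≤ r + d z x′
            x′y≤ x′∈ with ∈-map⁻ proj₂ x′∈
            ... | (x , x′) , p∈ , refl = ≤-trans (d-triangle x′ x y)
                  (+-mono-≤ (≤-respˡ (d-sym x x′) (displacement (moved inv p∈)))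
                    (≤-reflexive (≈-trans (d-sym x y) (≈-sym (agrees p∈)))))
            result : ∃[ z ] d z y ≤ r × (∀ {x x′} → (x , x′) ∈ˡ L → d z x′ ≈ d y x)
            result with adjust z y F r∈S 0<r r≤ zx′≤ x′y≤
            ... | z′ , z′y≈r , z′-agrees = z′ , ≤-reflexive z′y≈r ,
                  λ p∈ → ≈-trans (z′-agrees (∈-map⁺ proj₂ p∈)) (agrees p∈)

          -- Density supplies a point w of the colour of y so close to z that all distances to F
          -- other than the one to z are unchanged. Adding y to the list keeps w within r of y.
          recolour : ∀ {y z} F → V y → d z y ≤ r →
            ∃[ w ] c w ≡ c y × d w y ≤ r × (∀ {g} → g ∈ˡ F → g ≢ z → d w g ≈ d z g)
          recolour {y} {z} F Vy zy≤r with locallyConstant z (y ∷ F)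
          ... | η₁ , 0<η₁ , constant with minimum⁺ 0<η₁ 0<r
          ...   | η , 0<η , η≤η₁ , η≤r with dense (proj₁ (step Vy (≤-respˡ (d-sym z y) zy≤r))) Vy
                                                0<η
          ...     | w , zw<η , cw≡cy = w , cw≡cy , wy≤r ,
                    λ g∈F → constant (<-≤-trans zw<η η≤η₁) (there g∈F)
            where
            wy≤r : d w y ≤ r
            wy≤r with em {y ≡ z}
            ... | yes refl = ≤-trans (≤-reflexive (d-sym w y)) (≤-trans (<⇒≤ zw<η) η≤r)
            ... | no  y≢z  = ≤-trans (≤-reflexive (constant (<-≤-trans zw<η η≤η₁) (here refl) y≢z)) zy≤r

          -- As y is not yet in the domain of L, the candidate z differs from every x′ in its range,
          -- so recolouring preserves all required distances.
          newImage : ∀ {L} → Inv L → ∀ {y} → V y → (∀ y′ → (y , y′) ∉ˡ L) →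
            ∃[ w ] c w ≡ c y × d w y ≤ r × (∀ {x x′} → (x , x′) ∈ˡ L → d y x ≈ d w x′)
          newImage {L} inv {y} Vy y∉ =
            let z , zy≤r , z-agrees = nearbyImage inv y
                w , cw≡cy , wy≤r , w-agrees = recolour (map proj₂ L) Vy zy≤r
            in w , cw≡cy , wy≤r , λ {x} {x′} p∈ → ≈-sym (≈-trans
                 (w-agrees (∈-map⁺ proj₂ p∈) λ x′≡z → y∉ x′ (subst (λ x → (x , x′) ∈ˡ L)
                   (sym (d≈0⇒≡ (≈-trans (≈-sym (z-agrees p∈)) (≡⇒d≈0 (sym x′≡z))))) p∈))
                 (z-agrees p∈))

          insert : ∀ {L} → Inv L → ∀ {y w} → V y → c w ≡ c y → d w y ≤ r →
            (∀ {x x′} → (x , x′) ∈ˡ L → d y x ≈ d w x′) → Inv ((y , w) ∷ L)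
          insert inv {y} {w} Vy cw≡cy wy≤r =
            extend inv (sym cw≡cy , inj₂ (Vy , proj₁ (step Vy yw≤r) , yw≤r))
            where
            yw≤r : d y w ≤ r
            yw≤r = ≤-respˡ (d-sym w y) wy≤r

          forth : ∀ {L} → Inv L → ∀ y → ∃[ y′ ] Inv ((y , y′) ∷ L)
          forth {L} inv y with em {V y} | em {∃[ y′ ] (y , y′) ∈ˡ L}
          ... | yes _   | yes (y′ , p∈) = y′ , extend inv (moved inv p∈) (isometry inv p∈)
          ... | yes Vy  | no y∉ =
            let w , cw≡cy , wy≤r , agrees = newImage inv Vy (λ y′ p∈ → y∉ (y′ , p∈))
            in w , insert inv Vy cw≡cy wy≤r agrees
          -- Outside V the identity fits every earlier pair: such a pair is either fixed or moves
          -- within V by at most r, which `step` shows to be invisible from outside.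
          ... | no ¬Vy  | _ = y , extend inv (refl , inj₁ (¬Vy , refl)) iso
            where
            iso : ∀ {x x′} → (x , x′) ∈ˡ L → d y x ≈ d y x′
            iso p∈ with moved inv p∈
            ... | _ , inj₁ (_ , refl)         = ≈-refl
            ... | _ , inj₂ (Vx , _ , xx′≤r)   = proj₂ (step Vx xx′≤r) ¬Vy

          back : ∀ {L} → Inv L → ∀ y′ → ∃[ y ] Inv ((y , y′) ∷ L)
          back {L} inv y′ with forth (flip inv) y′
          ... | y , inv′ = y , subst (λ L → Inv ((y , y′) ∷ L))
                (trans (sym (map-∘ L)) (map-id L)) (flip inv′)

          Vv : V v
          Vv = <-respˡ (≈-sym (d-refl v)) 0<ρ

          -- This gives the starting pair (v, w) that makes the automorphism nontrivial. A point at
          -- distance r from v is recoloured without changing that distance, so w stays different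
          -- from v.
          sameColourNeighbour : ∃[ w ] w ≢ v × c v ≡ c w × d w v ≤ r
          sameColourNeighbour =
            let z , zv≈r = atDistance v r∈S 0<r
                w , cw≡cv , wv≤r , w-agrees = recolour (v ∷ []) Vv (≤-reflexive zv≈r)
                v≢z = d>0⇒≢ (<-respʳ (≈-trans (≈-sym zv≈r) (d-sym z v)) 0<r)
            in w , d>0⇒≢ (<-respʳ (≈-sym (≈-trans (w-agrees (here refl) v≢z) zv≈r)) 0<r) ,
               sym cw≡cv , wv≤r

          module Build {w} (w≢v : w ≢ v) (inv₀ : Inv ((v , w) ∷ [])) where

            open BackAndForth Inv isometry forth back inv₀

            invariant : Preserves c (proj₁ automorphism)
            invariant x with proj₂ automorphism x
            ... | n , p∈ = sym (proj₁ (moved (proj₂ (stages n)) p∈))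

            moves : to (proj₁ automorphism) v ≢ v
            moves gv≡v = w≢v (trans (d≈0⇒≡ (≈-trans
              (≈-sym (Related-isometry (0 , here refl) (proj₂ automorphism v))) (d-refl v))) gv≡v)

            invariantMove : ∃[ g ] Preserves c g × to g v ≢ v
            invariantMove = proj₁ automorphism , invariant , moves

          moveCentre : ∃[ g ] Preserves c g × to g v ≢ v
          moveCentre =
            let w , w≢v , cv≡cw , wv≤r = sameColourNeighbour
            in Build.invariantMove w≢v
                 (insert (record { moved = λ () ; isometry = λ () }) Vv (sym cv≡cw) wv≤r λ ())

    finitelyColoured⇒¬Rigid : ∀ {K : Set} (c : Point → K) ℓ → (∀ x → c x ∈ˡ ℓ) → ¬ Rigid c
    finitelyColoured⇒¬Rigid c ℓ covers rigid =
      let v , _ , ball = homogeneousBall c (suc (length ℓ)) point 0<1 ℓ (ℕ.n<1+n _) (λ _ → covers _)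
          _ , r∈S , 0<r , step = smallStep c ball
          g , preserves , moves = Move.moveCentre c ball r∈S 0<r step
      in moves (rigid g preserves v)

    blurred : Blurred
    blurred c rigid with em {∃[ ℓ ] ∀ x → c x ∈ˡ ℓ}
    ... | yes (ℓ , covers) = contradiction rigid (finitelyColoured⇒¬Rigid c ℓ covers)
    ... | no infinite = differentColours⇒↣ c
      (freshSequence (λ _ → ⊤) (λ x y → c x ≢ c y) tt λ {ℓ} _ → let x , new = newColour ℓ in
        x , tt , λ y∈ℓ eq → new (subst (_∈ˡ map c ℓ) (sym eq) (∈-map⁺ c y∈ℓ)))
      where
      newColour : ∀ ℓ → ∃[ x ] c x ∉ˡ map c ℓ
      newColour ℓ with em {∃[ x ] c x ∉ˡ map c ℓ}
      ... | yes found = found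
      ... | no ¬found = contradiction (map c ℓ , covers) infinite
        where
        covers : ∀ x → c x ∈ˡ map c ℓ
        covers x with em {c x ∈ˡ map c ℓ}
        ... | yes cx∈ = cx∈
        ... | no  cx∉ = contradiction (x , cx∉) ¬found

  -- The case distinction on the limits of S.

  leastPositive : ¬ ∃ (IsLimit S) → ∃ (IsLeastPositive S)
  -- The infimum of the positive elements of S is obtained as the supremum of their lower bounds. If
  -- it is not itself a positive element of S, it is a limit.
  leastPositive ¬limit = conclude (complete LowerBound
      (0# , λ _ → <⇒≤) (proj₁ positive , λ lower → lower (proj₁ (proj₂ positive)) (proj₂ (proj₂ positive))))
    where
    LowerBound : Pred Carrier 0ℓ
    LowerBound l = ∀ {s} → s ∈ S → 0# < s → l ≤ s
    conclude : ∃[ q ] q ∈ UpperBound LowerBound × (∀ {u} → u ∈ UpperBound LowerBound → q ≤ u) →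
               ∃ (IsLeastPositive S)
    conclude (q , upper , least) with em {q ∈ S × 0# < q}
    ... | yes (q∈S , 0<q) = q , q∈S , 0<q , λ s∈S 0<s → least λ lower → lower s∈S 0<s
    ... | no ¬positive = contradiction (q , limit) ¬limit
      where
      limit : IsLimit S q
      limit ε 0<ε with em {∃[ s ] s ∈ S × ¬ (s ≈ q) × q - ε < s × s < q + ε}
      ... | yes s = s
      ... | no isolated = contradiction (x<x+y 0<ε) (≤⇒≯ (upper λ {s} s∈S 0<s → ≮⇒≥ λ s<q+ε →
              isolated (s , s∈S , (λ s≈q → ¬positive (resp-≈ s≈q s∈S , <-respʳ s≈q 0<s)) ,
                <-≤-trans (x<z+y⇒x-y<z (x<x+y 0<ε)) (least λ lower → lower s∈S 0<s) , s<q+ε)))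

  large⊎Blurred : ¬ HasPositiveLimit S → IsLimit S 0# → LargeElementsOfSmallDistance S ⊎ Blurred
  large⊎Blurred ¬positiveLimit zeroLimit
    with em {∃₂ λ N ε → 0# < ε × (∀ {a b} → a ∈ S → b ∈ S → a < b → N ≤ a → a + ε ≤ b)}
  ... | yes (N , ε , 0<ε , gap) = inj₂ (SmallDisplacement.blurred ¬positiveLimit zeroLimit 0<ε gap)
  ... | no ¬gap = inj₁ large
    where
    large : LargeElementsOfSmallDistance S
    large N ε 0<ε with em {∃₂ λ a b → a ∈ S × b ∈ S × a < b × N ≤ a × b - a < ε}
    ... | yes found = found
    ... | no ¬found = contradiction (N , ε , 0<ε , λ {a} {b} a∈S b∈S a<b N≤a → ≮⇒≥ λ b<a+ε →
            ¬found (a , b , a∈S , b∈S , a<b , N≤a , x<z+y⇒x-y<z (<-respʳ (+-comm a ε) b<a+ε))) ¬gap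

  SmallGap : Carrier → Set
  SmallGap m = ∃₂ λ a b → a ∈ S × b ∈ S × 0# < a × a < b × b - a ≤ m

  smallGap⊎Blurred : ∀ {m} → IsLeastPositive S m → SmallGap m ⊎ Blurred
  smallGap⊎Blurred {m} isLeast with em {SmallGap m}
  ... | yes smallGap = inj₁ smallGap
  ... | no ¬smallGap = inj₂ (gaps⇒Blurred isLeast gap)
    where
    gap : ∀ {a b} → a ∈ S → b ∈ S → 0# < a → a < b → a + m < b
    gap {a} {b} a∈S b∈S 0<a a<b with <-≤-connex (a + m) b
    ... | inj₁ a+m<b = a+m<b
    ... | inj₂ b≤a+m = contradiction (a , b , a∈S , b∈S , 0<a , a<b ,
            +-cancelʳ-≤ a (≤-respˡ (≈-sym ([x-y]+y≈x b a)) (≤-respʳ (+-comm a m) b≤a+m))) ¬smallGap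

  smallGap⇒D≔2 : ∀ {m} → IsLeastPositive S m → SmallGap m → D U ≔ Fin 2
  smallGap⇒D≔2 (_ , _ , m≤) (_ , _ , a∈S , b∈S , 0<a , a<b , b-a≤m) =
    Rich⇒D≔2 (smallGap⇒Rich a∈S b∈S 0<a a<b b-a≤m m≤)

  noLimit : ¬ HasPositiveLimit S → ¬ IsLimit S 0# → ¬ ∃ (IsLimit S)
  noLimit ¬positiveLimit ¬zeroLimit (p , limit) with compare 0# p
  ... | tri< 0<p _ _ = ¬positiveLimit (p , 0<p , limit)
  ... | tri≈ _ 0≈p _ = ¬zeroLimit λ ε 0<ε → let s , s∈S , s≉p , p-ε<s , s<p+ε = limit ε 0<ε in
        s , s∈S , (λ s≈0 → s≉p (≈-trans s≈0 0≈p)) ,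
        <-respˡ (+-congʳ (≈-sym 0≈p)) p-ε<s , <-respʳ (+-congʳ (≈-sym 0≈p)) s<p+ε
  -- The radius -p around a negative p would yield a negative element of S.
  ... | tri> _ _ p<0 = let s , s∈S , _ , _ , s<p-p = limit (0# - p) (x<y⇒0<y-x p<0) in
        ≤⇒≯ (nonNegative s∈S) (<-respʳ (≈-trans (+-comm p _) ([x-y]+y≈x 0# p)) s<p-p)

  D≔2⊎D≔ℕ : (D U ≔ Fin 2) ⊎ (D U ≔ ℕ)
  D≔2⊎D≔ℕ with em {HasPositiveLimit S} | em {IsLimit S 0#}
  ... | yes positiveLimit | _ = inj₁ (Rich⇒D≔2 (positiveLimit⇒Rich positiveLimit))
  ... | no ¬positiveLimit | yes zeroLimit with large⊎Blurred ¬positiveLimit zeroLimit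
  ...   | inj₁ large   = inj₁ (Rich⇒D≔2 (large⇒Rich large))
  ...   | inj₂ blurred = inj₂ (Blurred⇒D≔ℕ blurred)
  D≔2⊎D≔ℕ | no ¬positiveLimit | no ¬zeroLimit with leastPositive (noLimit ¬positiveLimit ¬zeroLimit)
  ...   | m , isLeast with smallGap⊎Blurred isLeast
  ...     | inj₁ smallGap = inj₁ (smallGap⇒D≔2 isLeast smallGap)
  ...     | inj₂ blurred  = inj₂ (Blurred⇒D≔ℕ blurred)

  D≔2⇔large : ¬ HasPositiveLimit S → IsLimit S 0# → (D U ≔ Fin 2) ⇔ LargeElementsOfSmallDistance S
  D≔2⇔large ¬positiveLimit zeroLimit = mk⇔ only-if (λ large → Rich⇒D≔2 (large⇒Rich large))
    where
    only-if : D U ≔ Fin 2 → LargeElementsOfSmallDistance S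
    only-if D≔2 with large⊎Blurred ¬positiveLimit zeroLimit
    ... | inj₁ large   = large
    ... | inj₂ blurred = contradiction D≔2 (Blurred⇒¬D≔2 blurred)

  D≔2⇔smallGap : ¬ ∃ (IsLimit S) → ∃[ m ] IsLeastPositive S m × ((D U ≔ Fin 2) ⇔ SmallGap m)
  D≔2⇔smallGap ¬limit with leastPositive ¬limit
  ... | m , isLeast = m , isLeast , mk⇔ only-if (smallGap⇒D≔2 isLeast)
    where
    only-if : D U ≔ Fin 2 → SmallGap m
    only-if D≔2 with smallGap⊎Blurred isLeast
    ... | inj₁ smallGap = smallGap
    ... | inj₂ blurred  = contradiction D≔2 (Blurred⇒¬D≔2 blurred)

mainTheorem1 :
    ExcludedMiddle 0ℓ →
    (ℝ : CompleteOrderedField) →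
    let open CompleteOrderedField ℝ
        open Spectra ℝ in
    (S : Pred Carrier 0ℓ) → IsUniversalSpectrum S →
    (U : MetricSpace) → IsUrysohn S U →
    ((D U ≔ Fin 2) ⊎ (D U ≔ ℕ)) ×
    (HasPositiveLimit S → D U ≔ Fin 2) ×
    (¬ HasPositiveLimit S → IsLimit S 0# →
      (D U ≔ Fin 2) ⇔ LargeElementsOfSmallDistance S) ×
    (¬ ∃ (IsLimit S) →
      ∃[ m ] IsLeastPositive S m ×
        ((D U ≔ Fin 2) ⇔
          (∃₂ λ a b → a ∈ S × b ∈ S × 0# < a × a < b × b - a ≤ m)))
mainTheorem1 em ℝ S universal-S U urysohn =
  D≔2⊎D≔ℕ , (λ positiveLimit → Rich⇒D≔2 (positiveLimit⇒Rich positiveLimit)) , D≔2⇔large , D≔2⇔smallGap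
  where open Urysohn em ℝ S universal-S U urysohn
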